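{- Let $k,m,n,r$ be positive integers and let $G$ and $H$ be finite abelian groups. Then the following hold. (1) If $\gcd(|G|,|H|)=1$, then there are bijections between the sets $\mathsf M(G,|H|)$, $\mathsf M(H,|G|)$, and $\mathcal D_{|G|,|H|}$. Therefore $$|\mathsf M(G,|H|)|=|\mathsf M(H,|G|)|=\mathsf{Cat}_{|G|,|H|}.$$ (2) If $G=C_n^r$ and $H=C_m^r$ with $\gcd(n,m^r)=\gcd(n^r,m)$, then $$|\mathsf M(G,|H|)|=|\mathsf M(H,|G|)|.$$ (3) If $k<|G|$ and $\gcd(k,|G|)=1$, then there are bijections between the sets $\mathsf N(G,k)$, $\mathsf N(G,|G|-k)$, and $\mathcal D_{k,|G|-k}$. Therefore $$|\mathsf N(G,k)|=|\mathsf N(G,|G|-k)|=\frac{1}{|G|}\binom{|G|}{k}=\mathsf{Cat}_{k,|G|-k}.$$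
   Context: Groups are written additively. $C_n$ denotes the cyclic group of order $n$ and $C_n^r$ the direct sum of $r$ copies of $C_n$. A sequence over a finite abelian group $G$ is a finite unordered sequence of elements of $G$ with repetition allowed (that is, a finite multiset of elements of $G$); its length $|S|$ is the number of terms counted with multiplicity, and $\sigma(S)\in G$ is the sum of its terms counted with multiplicity. For a subset $S\subseteq G$, $\sigma(S)$ is the sum of its elements and $|S|$ its cardinality. For a positive integer $m$, $\mathsf M(G,m)$ is the set of all sequences $S$ over $G$ with $|S|=m$ and $\sigma(S)=0$. For a positive integer $k\le |G|$, $\mathsf N(G,k)$ is the set of all subsets $S\subseteq G$ with $|S|=k$ and $\sigma(S)=0$. For coprime positive integers $a,b$, the rational Catalan number is $\mathsf{Cat}_{a,b}=\frac{1}{a+b}\binom{a+b}{a}$, and $\mathcal D_{a,b}$ is the set of all $(a,b)$-Dyck paths, i.e. lattice paths from $(0,0)$ to $(a,b)$ which use only unit steps $(1,0)$ and $(0,1)$ and stay (weakly) above the diagonal line $y=\frac{b}{a}x$. -}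

module Defs where

open import Algebra.Bundles using (AbelianGroup)
open import Algebra.Morphism.Structures using (module GroupMorphisms)
import Algebra.Construct.Pointwise as Pointwise
open import Data.Fin.Base using (Fin)
import Data.Fin.Properties as Fin
import Data.Fin.Subset as Subset
open import Data.Fin.Subset using (Subset)
open import Data.Fin.Subset.Properties using (_∈?_)
open import Data.Integer.Base as ℤ using (ℤ; +_; 0ℤ)
import Data.Integer.Properties as ℤ
open import Data.Integer.Divisibility.Signed as ℤ
  using (∣m∣n⇒∣m+n; ∣m⇒∣-m) renaming (_∣_ to _∣ℤ_)
open import Data.Integer.Tactic.RingSolver using (solve-∀)
open import Data.List.Base using (List; []; _∷_; length; map; foldr; foldl; filter; allFin)
import Data.List.Relation.Binary.Permutation.Setoid as Permutation
open import Data.List.Relation.Unary.All using (All)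
open import Data.Nat.Base using (ℕ; suc; _+_; _*_; _≤_; NonZero)
open import Data.Nat.Combinatorics using (_C_)
open import Data.Product.Base using (Σ; Σ-syntax; _×_; _,_; proj₁)
open import Data.Rational.Base using (ℚ; _/_)
open import Function.Bundles using (Bijection)
open import Level using (Level; _⊔_; 0ℓ)
open import Relation.Binary.Bundles using (Setoid)
import Relation.Binary.Construct.On as On
open import Relation.Binary.PropositionalEquality as ≡ using (_≡_; refl; subst)

private
  variable
    a ℓ a₁ ℓ₁ a₂ ℓ₂ : Level

HasCardinality : Setoid a ℓ → ℕ → Set (a ⊔ ℓ)
HasCardinality X n = Bijection (≡.setoid (Fin n)) X

record FiniteAbelianGroup c ℓ : Set (Level.suc (c ⊔ ℓ)) where
  field
    abelianGroup : AbelianGroup c ℓ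

  open AbelianGroup abelianGroup public

  field
    order  : ℕ
    finite : HasCardinality setoid order

  element : Fin order → Carrier
  element = Bijection.to finite

open FiniteAbelianGroup public using (order)

order-nonZero : (G : FiniteAbelianGroup a ℓ) → NonZero (order G)
order-nonZero G = Fin.nonZeroIndex (proj₁ (Bijection.surjective finite ε))
  where open FiniteAbelianGroup G

infix 4 _≅_

_≅_ : AbelianGroup a₁ ℓ₁ → AbelianGroup a₂ ℓ₂ → Set (a₁ ⊔ ℓ₁ ⊔ a₂ ⊔ ℓ₂)
G ≅ H = Σ[ f ∈ (G.Carrier → H.Carrier) ] IsGroupIsomorphism f
  where
  module G = AbelianGroup G
  module H = AbelianGroup H
  open GroupMorphisms G.rawGroup H.rawGroup

-- ℤ/nℤ: integers, with equality being congruence modulo n.  It has order n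
-- when n is positive (and is ℤ itself when n is 0).
Cyclic : ℕ → AbelianGroup 0ℓ 0ℓ
Cyclic n = record
  { Carrier = ℤ
  ; _≈_ = _≈_
  ; _∙_ = ℤ._+_
  ; ε = 0ℤ
  ; _⁻¹ = ℤ.-_
  ; isAbelianGroup = record
    { isGroup = record
      { isMonoid = record
        { isSemigroup = record
          { isMagma = record
            { isEquivalence = record
              { refl  = λ {x} → ≡⇒≈ {x} refl
              ; sym   = λ {x} {y} p → subst (+ n ∣ℤ_) (neg x y) (∣m⇒∣-m p)
              ; trans = λ {x} {y} {z} p q →
                  subst (+ n ∣ℤ_) (telescope x y z) (∣m∣n⇒∣m+n p q)
              }
            ; ∙-cong = λ {x} {y} {u} {v} p q →
                subst (+ n ∣ℤ_) (add x y u v) (∣m∣n⇒∣m+n p q)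
            }
          ; assoc = λ x y z → ≡⇒≈ (ℤ.+-assoc x y z)
          }
        ; identity = (λ x → ≡⇒≈ (ℤ.+-identityˡ x)) , (λ x → ≡⇒≈ (ℤ.+-identityʳ x))
        }
      ; inverse = (λ x → ≡⇒≈ (ℤ.+-inverseˡ x)) , (λ x → ≡⇒≈ (ℤ.+-inverseʳ x))
      ; ⁻¹-cong = λ {x} {y} p → subst (+ n ∣ℤ_) (neg-sub x y) (∣m⇒∣-m p)
      }
    ; comm = λ x y → ≡⇒≈ (ℤ.+-comm x y)
    }
  }
  where
  _≈_ : ℤ → ℤ → Set
  x ≈ y = + n ∣ℤ (x ℤ.- y)

  ≡⇒≈ : ∀ {x y} → x ≡ y → x ≈ y
  ≡⇒≈ {x} refl = ℤ.divides 0ℤ (ℤ.+-inverseʳ x)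

  neg : ∀ x y → ℤ.- (x ℤ.- y) ≡ y ℤ.- x
  neg = solve-∀

  telescope : ∀ x y z → (x ℤ.- y) ℤ.+ (y ℤ.- z) ≡ x ℤ.- z
  telescope = solve-∀

  add : ∀ x y u v → (x ℤ.- y) ℤ.+ (u ℤ.- v) ≡ (x ℤ.+ u) ℤ.- (y ℤ.+ v)
  add = solve-∀

  neg-sub : ∀ x y → ℤ.- (x ℤ.- y) ≡ (ℤ.- x) ℤ.- (ℤ.- y)
  neg-sub = solve-∀

CyclicPower : ℕ → ℕ → AbelianGroup 0ℓ 0ℓ
CyclicPower n r = Pointwise.abelianGroup (Fin r) (Cyclic n)

module _ (G : FiniteAbelianGroup a ℓ) where
  open FiniteAbelianGroup G using (Carrier; _≈_; _∙_; ε; setoid; element)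

  σ : List Carrier → Carrier
  σ = foldr _∙_ ε

  -- Sequences (finite multisets) are lists up to permutation.
  M : ℕ → Setoid (a ⊔ ℓ) (a ⊔ ℓ)
  M m = On.setoid {B = Σ[ S ∈ List Carrier ] (length S ≡ m × σ S ≈ ε)}
                  (Permutation.↭-setoid setoid) proj₁

  -- Subsets of G are given by the indices of their elements in the
  -- enumeration of G.
  elements : Subset (order G) → List Carrier
  elements S = map element (filter (_∈? S) (allFin (order G)))

  N : ℕ → Setoid ℓ 0ℓ
  N k = On.setoid {B = Σ[ S ∈ Subset (order G) ] (Subset.∣ S ∣ ≡ k × σ (elements S) ≈ ε)}
                  (≡.setoid (Subset (order G))) proj₁

Point : Set
Point = ℕ × ℕ

data Step : Set where
  east north : Step

move : Point → Step → Point
move (x , y) east  = suc x , y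
move (x , y) north = x , suc y

vertices : Point → List Step → List Point
vertices p []       = p ∷ []
vertices p (s ∷ ss) = p ∷ vertices (move p s) ss

-- y ≥ (b / a) x, with the denominator a > 0 cleared.  A path stays above the
-- line iff its vertices do, as its steps are line segments.
Above : ℕ → ℕ → Point → Set
Above a b (x , y) = b * x ≤ a * y

IsDyck : ℕ → ℕ → List Step → Set
IsDyck a b p = foldl move (0 , 0) p ≡ (a , b) × All (Above a b) (vertices (0 , 0) p)

Dyck : ℕ → ℕ → Setoid 0ℓ 0ℓ
Dyck a b = On.setoid {B = Σ (List Step) (IsDyck a b)} (≡.setoid (List Step)) proj₁

fromℕ : ℕ → ℚ
fromℕ n = + n / 1

-- The rational Catalan number, as the rational number (1 / (a + b)) · binom (a + b) a.
Cat : (a b : ℕ) .{{_ : NonZero a}} → ℚ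
Cat a b = (+ ((a + b) C a) / (a + b)) {{sum-nonZero a b}}
  where
  sum-nonZero : ∀ a b .{{_ : NonZero a}} → NonZero (a + b)
  sum-nonZero (suc _) _ = _

{-# OPTIONS --safe #-}
module Submission where

-- Translating a multiset of size m by t changes its sum by m · t.  Hence, if m is prime to |G|, all sums are equally
-- frequent and |G| · |M(G,m)| is the number of all multisets of size m; the same holds for subsets.  Dyck paths are
-- counted by the cycle lemma, and all bijections come from equal cardinalities.
--
-- Without coprimality, the number W(m,s) of multisets of size m and sum s satisfies Newton's identity
-- m W(m,s) = Σ_{1≤k≤m} Σ_{y∈G} W(m−k, s−ky).  For G = Cₙʳ it is solved by expanding in the sums of the characters of
-- each order d ∣ n.  This gives |G| · |M(G,m)| = Σ_{d∣n} J_r(d) [xᵐ] (1 − xᵈ)^(−|G|/d), where J_r is Jordan's totient,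
-- and the coefficient times m is symmetric in |G| and m.

open import Defs
import Algebra.Properties.AbelianGroup
import Algebra.Properties.CommutativeSemigroup
import Algebra.Properties.Group
import Algebra.Properties.Monoid.Mult
open import Algebra.Bundles using (AbelianGroup)
open import Algebra.Morphism.Structures using (module GroupMorphisms)
open import Data.Bool.Base using (true; false)
open import Data.Empty using (⊥-elim)
open import Data.Fin.Base using (Fin; zero; suc)
import Data.Fin.Properties as Fin
open import Data.Fin.Subset using (Subset; ∣_∣; inside; outside)
open import Data.Fin.Subset.Properties using (_∈?_)
open import Data.Integer.Base as ℤ using (ℤ; +_; 0ℤ; 1ℤ)
import Data.Integer.Divisibility.Signed as ℤ
open import Data.Integer.Divisibility.Signed using () renaming (_∣_ to _∣ℤ_; _∣?_ to _∣ℤ?_)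
open import Data.Integer.DivMod using (_%ℕ_; _/ℕ_; n%ℕd<d; a≡a%ℕn+[a/ℕn]*n)
import Data.Integer.Properties as ℤ
open import Data.Integer.Tactic.RingSolver using (solve-∀)
open import Data.List.Base
  using (List; []; _∷_; _++_; _∷ʳ_; map; filter;
  tabulate; length; lookup; foldl; take; drop; initLast; _∷ʳ′_; downFrom; allFin; cartesianProductWith)
import Data.List.Membership.Setoid as SetoidMembership
import Data.List.Membership.Setoid.Properties as SetoidMembershipₚ
open import Data.List.Membership.Propositional using (_∈_)
open import Data.List.Membership.Propositional.Properties
  using (∈-lookup; ∈-map⁺; ∈-map⁻; ∈-filter⁺; ∈-filter⁻; ∈-downFrom⁺; ∈-downFrom⁻; ∈-allFin)
import Data.List.Properties as List
import Data.List.Relation.Binary.Permutation.Setoid as Permutation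
import Data.List.Relation.Binary.Permutation.Setoid.Properties as Permutationₚ
open import Data.List.Relation.Binary.Pointwise using ([]; _∷_)
open import Data.List.Relation.Unary.All as All using (All; []; _∷_)
import Data.List.Relation.Unary.All.Properties as Allₚ
open import Data.List.Relation.Unary.AllPairs as AllPairs using ([]; _∷_)
import Data.List.Relation.Unary.AllPairs.Properties as AllPairsₚ
open import Data.List.Relation.Unary.Any as Any using (here; there)
import Data.List.Relation.Unary.Any.Properties as Anyₚ
import Data.List.Relation.Unary.Unique.Propositional.Properties as Unique
import Data.List.Relation.Unary.Unique.Setoid as UniqueSetoid
import Data.List.Relation.Unary.Unique.Setoid.Properties as UniqueSetoidₚ
open import Data.Nat.Base as ℕ using (ℕ; zero; suc; _<_; _∸_; _^_; NonZero)
open import Data.Nat.Combinatorics using (_C_; nCn≡1; nCk≡nC[n∸k]; nCk+nC[k+1]≡[n+1]C[k+1])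
open import Data.Nat.Coprimality using (coprime-divisor; coprime⇒gcd≡1; gcd≡1⇒coprime)
open import Data.Nat.Divisibility
  using (_∣_; _∣?_; divides; ∣⇒≤; ∣-refl; ∣-trans; ∣m+n∣m⇒∣n; ∣m∣n⇒∣m+n; ∣m∸n∣n⇒∣m; m∣m*n; n∣m*n; 0∣⇒≡0)
open import Data.Nat.GCD using (gcd; gcd-GCD; gcd-comm; gcd-greatest; gcd[m,n]∣m; gcd[m,n]∣n; module GCD; module Bézout)
open import Data.Nat.Induction using (<-rec)
import Data.Nat.Properties as ℕ
open import Data.Product.Base using (Σ; Σ-syntax; ∃-syntax; _×_; _,_; proj₁; proj₂)
open import Data.Rational.Base using (_/_)
import Data.Rational.Properties as ℚ
open import Data.Rational.Unnormalised.Base using (*≡*; mkℚᵘ)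
open import Data.Sum.Base using (_⊎_; inj₁; inj₂; [_,_]′)
open import Data.Vec.Base using ([]; _∷_)
open import Data.Vec.Functional using () renaming (_∷_ to _∷ᶠ_)
import Data.Vec.Properties as Vec
open import Function.Base using (_∘_; id; case_of_)
open import Function.Bundles using (Bijection)
import Function.Construct.Symmetry as Symmetry
import Function.Properties.Bijection as Bijection
import Function.Properties.Inverse as Inverse
open import Level using (Level)
open import Relation.Binary.Bundles using (Setoid)
import Relation.Binary.Construct.On as On
open import Relation.Binary.Definitions using (tri<; tri≈; tri>)
open import Relation.Binary.PropositionalEquality as ≡ using (_≡_; refl; sym; trans; cong; cong₂; subst; subst₂)
import Relation.Binary.Reasoning.Setoid as SetoidReasoning
open import Relation.Nullary.Decidable using (Dec; does; yes; no; map′)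
open import Relation.Nullary.Negation using (¬_; contradiction)

open Algebra.Properties.AbelianGroup ℤ.+-0-abelianGroup using () renaming (∙-cancelʳ to +-cancelʳ)
open Algebra.Properties.CommutativeSemigroup ℤ.+-commutativeSemigroup using ()
  renaming (interchange to +-interchange; x∙yz≈y∙xz to +-left-comm)
open Algebra.Properties.CommutativeSemigroup ℤ.*-commutativeSemigroup using () renaming (x∙yz≈y∙xz to *-left-comm)

-- No character is ever written down. All that is needed of the characters of Cₙʳ whose order
-- divides d is their sum, which is an integer: dʳ at elements whose coordinates are all divisible
-- by d, and 0 elsewhere. Its Möbius inverse over the divisors of n isolates order exactly d, so the
-- whole argument takes place in ℤ, where the inversion can subtract and a nonzero factor can be
-- cancelled. The closed formula is checked rather than derived: (1 - xᵈ)^(-|G|/d) satisfies,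
-- coefficient by coefficient, the recurrence that Newton's identity imposes on the component of
-- order d, and both sides agree at m = 0. The summand at d vanishes unless d divides both |G| and
-- m. For m = |H| the sum over d ∣ n therefore shrinks to d ∣ gcd(n, |H|), and for the other group
-- to d ∣ gcd(m, |G|); the gcd condition says that these are the same d.

private
  variable
    a b c ℓ p : Level
    A B : Set a
    P Q : Set p

-- Finite sums over lists and indicators

∑ : List A → (A → ℤ) → ℤ
∑ []       F = 0ℤ
∑ (x ∷ xs) F = F x ℤ.+ ∑ xs F

∑-cong-∈ : ∀ (xs : List A) {F F′} → (∀ {x} → x ∈ xs → F x ≡ F′ x) → ∑ xs F ≡ ∑ xs F′
∑-cong-∈ []       F≗ = refl
∑-cong-∈ (x ∷ xs) F≗ = cong₂ ℤ._+_ (F≗ (here refl)) (∑-cong-∈ xs (F≗ ∘ there))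

∑-cong : ∀ (xs : List A) {F F′} → (∀ x → F x ≡ F′ x) → ∑ xs F ≡ ∑ xs F′
∑-cong xs F≗ = ∑-cong-∈ xs λ {x} _ → F≗ x

∑-const : ∀ (xs : List A) c → ∑ xs (λ _ → c) ≡ + length xs ℤ.* c
∑-const []       c = refl
∑-const (x ∷ xs) c = trans (cong (λ z → c ℤ.+ z) (∑-const xs c)) (sym (ℤ.suc-* (+ length xs) c))

∑-zero : ∀ (xs : List A) {F} → (∀ {x} → x ∈ xs → F x ≡ 0ℤ) → ∑ xs F ≡ 0ℤ
∑-zero xs F≗0 = trans (∑-cong-∈ xs F≗0) (trans (∑-const xs 0ℤ) (ℤ.*-zeroʳ (+ length xs)))

∑-+ : ∀ (xs : List A) F F′ → ∑ xs (λ x → F x ℤ.+ F′ x) ≡ ∑ xs F ℤ.+ ∑ xs F′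
∑-+ []       F F′ = refl
∑-+ (x ∷ xs) F F′ = trans (cong (λ z → F x ℤ.+ F′ x ℤ.+ z) (∑-+ xs F F′))
  (+-interchange (F x) (F′ x) (∑ xs F) (∑ xs F′))

*-distribˡ-∑ : ∀ c (xs : List A) F → c ℤ.* ∑ xs F ≡ ∑ xs (λ x → c ℤ.* F x)
*-distribˡ-∑ c []       F = ℤ.*-zeroʳ c
*-distribˡ-∑ c (x ∷ xs) F = trans (ℤ.*-distribˡ-+ c (F x) (∑ xs F))
  (cong (λ z → c ℤ.* F x ℤ.+ z) (*-distribˡ-∑ c xs F))

*-distribʳ-∑ : ∀ c (xs : List A) F → ∑ xs F ℤ.* c ≡ ∑ xs (λ x → F x ℤ.* c)
*-distribʳ-∑ c xs F = trans (ℤ.*-comm (∑ xs F) c)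
  (trans (*-distribˡ-∑ c xs F) (∑-cong xs λ x → ℤ.*-comm c (F x)))

∑-swap : ∀ (xs : List A) (ys : List B) (F : A → B → ℤ) →
         ∑ xs (λ x → ∑ ys (F x)) ≡ ∑ ys (λ y → ∑ xs (λ x → F x y))
∑-swap []       ys F = sym (∑-zero ys λ _ → refl)
∑-swap (x ∷ xs) ys F = trans (cong (λ z → ∑ ys (F x) ℤ.+ z) (∑-swap xs ys F)) (sym (∑-+ ys (F x) _))

∑-map : ∀ (f : A → B) xs F → ∑ (map f xs) F ≡ ∑ xs (F ∘ f)
∑-map f []       F = refl
∑-map f (x ∷ xs) F = cong (λ z → F (f x) ℤ.+ z) (∑-map f xs F)

∑-++ : ∀ (xs ys : List A) F → ∑ (xs ++ ys) F ≡ ∑ xs F ℤ.+ ∑ ys F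
∑-++ []       ys F = sym (ℤ.+-identityˡ _)
∑-++ (x ∷ xs) ys F = trans (cong (λ z → F x ℤ.+ z) (∑-++ xs ys F)) (sym (ℤ.+-assoc (F x) _ _))

∑-downFrom-+ : ∀ m n F → ∑ (downFrom (m ℕ.+ n)) F ≡ ∑ (downFrom m) (λ i → F (i ℕ.+ n)) ℤ.+ ∑ (downFrom n) F
∑-downFrom-+ zero    n F = sym (ℤ.+-identityˡ _)
∑-downFrom-+ (suc m) n F = trans (cong (λ z → F (m ℕ.+ n) ℤ.+ z) (∑-downFrom-+ m n F)) (sym (ℤ.+-assoc (F (m ℕ.+ n)) _ _))

𝟙 : Dec P → ℤ
𝟙 (yes _) = 1ℤ
𝟙 (no  _) = 0ℤ

𝟙-yes : (P? : Dec P) → P → 𝟙 P? ≡ 1ℤ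
𝟙-yes (yes _) p = refl
𝟙-yes (no ¬p) p = contradiction p ¬p

𝟙-no : (P? : Dec P) → ¬ P → 𝟙 P? ≡ 0ℤ
𝟙-no (yes p) ¬p = contradiction p ¬p
𝟙-no (no _)  ¬p = refl

𝟙-cong : (P? : Dec P) (Q? : Dec Q) → (P → Q) → (Q → P) → 𝟙 P? ≡ 𝟙 Q?
𝟙-cong (yes p) Q? f g = sym (𝟙-yes Q? (f p))
𝟙-cong (no ¬p) Q? f g = sym (𝟙-no Q? (¬p ∘ g))

-- Duplicate-free lists over a setoid, and cardinalities

module _ (S : Setoid a ℓ) where
  open Setoid S using (Carrier; _≈_) renaming (refl to ≈-refl; sym to ≈-sym; trans to ≈-trans)
  open SetoidMembership S renaming (_∈_ to _∈′_)
  open UniqueSetoid S using (Unique)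
  open Permutation S using (_↭_; prep; swap; ↭-refl; ↭-sym; ↭-trans) renaming (refl to ≋⇒↭; trans to _⨾_)

  ∑-↭ : ∀ {xs ys} F → (∀ {x y} → x ≈ y → F x ≡ F y) → xs ↭ ys → ∑ xs F ≡ ∑ ys F
  ∑-↭ F F-cong (≋⇒↭ [])          = refl
  ∑-↭ F F-cong (≋⇒↭ (x≈y ∷ r))   = cong₂ ℤ._+_ (F-cong x≈y) (∑-↭ F F-cong (≋⇒↭ r))
  ∑-↭ F F-cong (prep x≈y r)       = cong₂ ℤ._+_ (F-cong x≈y) (∑-↭ F F-cong r)
  ∑-↭ {x ∷ y ∷ xs} {y′ ∷ x′ ∷ ys} F F-cong (swap x≈x′ y≈y′ r) =
    trans (cong₂ ℤ._+_ (F-cong x≈x′) (cong₂ ℤ._+_ (F-cong y≈y′) (∑-↭ F F-cong r)))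
          (+-left-comm (F x′) (F y′) (∑ ys F))
  ∑-↭ F F-cong (r ⨾ r′)       = trans (∑-↭ F F-cong r) (∑-↭ F F-cong r′)

  ∈⇒↭∷ : ∀ {x ys} → x ∈′ ys → Σ[ zs ∈ List Carrier ] ys ↭ x ∷ zs
  ∈⇒↭∷ (here {xs = zs} x≈y) = zs , prep (≈-sym x≈y) ↭-refl
  ∈⇒↭∷ (there {x = y} x∈ys) with zs , r ← ∈⇒↭∷ x∈ys =
    y ∷ zs , ↭-trans (prep ≈-refl r) (swap ≈-refl ≈-refl ↭-refl)

  -- Turns a bijection of finite sets into an invariance of sums: a translated group, rotated words,
  -- the image of an isomorphism and the divisors of a gcd are all compared with another list in
  -- this way.
  unique⇒↭ : ∀ {xs ys} → Unique xs → Unique ys →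
             (∀ {z} → z ∈′ xs → z ∈′ ys) → (∀ {z} → z ∈′ ys → z ∈′ xs) → xs ↭ ys
  unique⇒↭ {[]} {[]}     _ _ _ _ = ≋⇒↭ []
  unique⇒↭ {[]} {y ∷ ys} _ _ _ ys⊆ with () ← ys⊆ (here ≈-refl)
  unique⇒↭ {x ∷ xs} {ys} (x∉xs ∷ u) v xs⊆ ys⊆ with zs , r ← ∈⇒↭∷ (xs⊆ (here ≈-refl)) = go (Permutationₚ.Unique-resp-↭ S r v)
    where
    go : Unique (x ∷ zs) → x ∷ xs ↭ ys
    go (x∉zs ∷ w) = ↭-trans (prep ≈-refl (unique⇒↭ u w xs⊆zs zs⊆xs)) (↭-sym r)
      where
      xs⊆zs : ∀ {z} → z ∈′ xs → z ∈′ zs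
      xs⊆zs z∈xs with Permutationₚ.∈-resp-↭ S r (xs⊆ (there z∈xs))
      ... | there z∈zs = z∈zs
      ... | here z≈x   = ⊥-elim (SetoidMembershipₚ.All[≉]⇒∉ S x∉xs (SetoidMembershipₚ.∈-resp-≈ S z≈x z∈xs))
      zs⊆xs : ∀ {z} → z ∈′ zs → z ∈′ xs
      zs⊆xs z∈zs with ys⊆ (Permutationₚ.∈-resp-↭ S (↭-sym r) (there z∈zs))
      ... | there z∈xs = z∈xs
      ... | here z≈x   = ⊥-elim (SetoidMembershipₚ.All[≉]⇒∉ S x∉zs (SetoidMembershipₚ.∈-resp-≈ S z≈x z∈zs))

  ∑-𝟙-unique : ∀ {P : Carrier → Set p} (P? : ∀ x → Dec (P x)) → (∀ {x y} → x ≈ y → P x → P y) →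
               ∀ {x xs} → Unique xs → x ∈′ xs → P x → (∀ {y} → y ∈′ xs → P y → y ≈ x) →
               ∑ xs (λ y → 𝟙 (P? y)) ≡ 1ℤ
  ∑-𝟙-unique P? P-resp {x} u x∈xs px unique with zs , r ← ∈⇒↭∷ x∈xs
                                            with x∉zs ∷ _ ← Permutationₚ.Unique-resp-↭ S r u =
    trans (∑-↭ _ (λ {y} {z} y≈z → 𝟙-cong (P? y) (P? z) (P-resp y≈z) (P-resp (≈-sym y≈z))) r)
          (cong₂ ℤ._+_ (𝟙-yes (P? x) px) (∑-zero zs λ {y} y∈zs → 𝟙-no (P? y) λ py →
            All.lookup x∉zs y∈zs (≈-sym (unique (Permutationₚ.∈-resp-↭ S (↭-sym r)
              (there (Any.map Setoid-reflexive y∈zs))) py))))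
    where
    Setoid-reflexive : ∀ {x y} → x ≡ y → x ≈ y
    Setoid-reflexive refl = ≈-refl

  lookup-injective : ∀ {xs} → Unique xs → ∀ {i j} → lookup xs i ≈ lookup xs j → i ≡ j
  lookup-injective (x∉xs ∷ u) {zero}  {zero}  eq = refl
  lookup-injective (x∉xs ∷ u) {zero}  {suc j} eq = contradiction eq (All.lookup x∉xs (∈-lookup j))
  lookup-injective (x∉xs ∷ u) {suc i} {zero}  eq = contradiction (≈-sym eq) (All.lookup x∉xs (∈-lookup i))
  lookup-injective (x∉xs ∷ u) {suc i} {suc j} eq = cong suc (lookup-injective u eq)

  -- Equality in the Σ-type looks at the first component only, so proofs of `P` need not be unique.
  enumeration⇒cardinality : ∀ (P : Carrier → Set p) {xs} → Unique xs → All P xs → (∀ {x} → P x → x ∈′ xs) →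
                            HasCardinality (On.setoid {B = Σ Carrier P} S proj₁) (length xs)
  enumeration⇒cardinality P {xs} u all complete = record
    { to        = λ i → lookup xs i , All.lookup all (∈-lookup i)
    ; cong      = λ { refl → ≈-refl }
    ; bijective = lookup-injective u , λ (x , px) → Any.index (complete px) ,
        λ { refl → ≈-sym (Anyₚ.lookup-index (complete px)) }
    }

∑-downFrom-𝟙-unique : ∀ {P : ℕ → Set p} (P? : ∀ i → Dec (P i)) n {i} → i < n → P i →
                      (∀ {j} → j < n → P j → j ≡ i) → ∑ (downFrom n) (λ j → 𝟙 (P? j)) ≡ 1ℤ
∑-downFrom-𝟙-unique P? n i<n pi unique =
  ∑-𝟙-unique (≡.setoid ℕ) P? (λ { refl p → p }) (Unique.downFrom⁺ n) (∈-downFrom⁺ i<n) pi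
    (unique ∘ ∈-downFrom⁻)

-- Binomial and multiset coefficients

-- The binomial coefficient C(l + m - 1, m), given by the recursion that `multisets` follows; this
-- also avoids a truncated subtraction at l = m = 0.
multichoose : ℕ → ℕ → ℕ
multichoose zero    zero    = 1
multichoose zero    (suc m) = 0
multichoose (suc l) zero    = multichoose l zero
multichoose (suc l) (suc m) = multichoose l (suc m) ℕ.+ multichoose (suc l) m

nC0≡1 : ∀ n → n C 0 ≡ 1
nC0≡1 n = trans (nCk≡nC[n∸k] {n = n} ℕ.z≤n) (nCn≡1 n)

-- Compares the coefficients of xᵐ in the derivative of (1 - x)^(-l), which is l (1 - x)^(-l-1).
multichoose-suc : ∀ l m → suc m ℕ.* multichoose l (suc m) ≡ l ℕ.* multichoose (suc l) m
multichoose-suc zero    m       = ℕ.*-zeroʳ (suc m)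
multichoose-suc (suc l) zero    = trans (ℕ.+-identityʳ _) (trans
  (cong (ℕ._+ multichoose l 0) (trans (sym (ℕ.+-identityʳ _)) (multichoose-suc l zero))) (ℕ.+-comm _ (multichoose l 0)))
multichoose-suc (suc l) (suc m) = begin
  suc (suc m) ℕ.* (x ℕ.+ y)              ≡⟨ ℕ.*-distribˡ-+ (suc (suc m)) x y ⟩
  suc (suc m) ℕ.* x ℕ.+ (y ℕ.+ suc m ℕ.* y) ≡⟨ cong₂ (λ i j → i ℕ.+ (y ℕ.+ j)) (multichoose-suc l (suc m))
                                                      (multichoose-suc (suc l) m) ⟩
  l ℕ.* y ℕ.+ (y ℕ.+ suc l ℕ.* z)         ≡⟨ ℕ.+-assoc (l ℕ.* y) y _ ⟨
  l ℕ.* y ℕ.+ y ℕ.+ suc l ℕ.* z           ≡⟨ cong (ℕ._+ suc l ℕ.* z) (ℕ.+-comm (l ℕ.* y) y) ⟩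
  suc l ℕ.* y ℕ.+ suc l ℕ.* z             ≡⟨ ℕ.*-distribˡ-+ (suc l) y z ⟨
  suc l ℕ.* (y ℕ.+ z)                     ∎
  where
  open ≡.≡-Reasoning
  x y z : ℕ
  x = multichoose l (suc (suc m))
  y = multichoose (suc l) (suc m)
  z = multichoose (suc (suc l)) m

multichoose-zeroʳ : ∀ l → multichoose l 0 ≡ 1
multichoose-zeroʳ zero    = refl
multichoose-zeroʳ (suc l) = multichoose-zeroʳ l

-- Both recursions are Pascal's rule for C(l + m, m), with the two branches exchanged.
multichoose-suc-comm : ∀ l m → multichoose (suc l) m ≡ multichoose (suc m) l
multichoose-suc-comm zero    zero    = refl
multichoose-suc-comm zero    (suc m) = multichoose-suc-comm zero m
multichoose-suc-comm (suc l) zero    = multichoose-suc-comm l zero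
multichoose-suc-comm (suc l) (suc m) = trans
  (cong₂ ℕ._+_ (multichoose-suc-comm l (suc m)) (multichoose-suc-comm (suc l) m))
  (ℕ.+-comm (multichoose (suc (suc m)) l) _)

-- For positive l and m both sides are (l + m - 1)! / ((l - 1)! (m - 1)!). This symmetry is what
-- exchanges the two groups in the count of zero-sum multisets.
multichoose-swap : ∀ l m → m ℕ.* multichoose l m ≡ l ℕ.* multichoose m l
multichoose-swap l       (suc m) = trans (multichoose-suc l m) (cong (l ℕ.*_) (multichoose-suc-comm l m))
multichoose-swap zero    zero    = refl
multichoose-swap (suc l) zero    = sym (ℕ.*-zeroʳ l)

multichoose-suc≡C : ∀ l m → multichoose (suc l) m ≡ (l ℕ.+ m) C m
multichoose-suc≡C l       zero    = trans (multichoose-zeroʳ (suc l)) (sym (nC0≡1 (l ℕ.+ 0)))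
multichoose-suc≡C zero    (suc m) = trans (multichoose-suc≡C zero m) (trans (nCn≡1 m) (sym (nCn≡1 (suc m))))
multichoose-suc≡C (suc l) (suc m) = trans (cong₂ ℕ._+_ (multichoose-suc≡C l (suc m)) (multichoose-suc≡C (suc l) m))
  (trans (ℕ.+-comm ((l ℕ.+ suc m) C suc m) _)
    (trans (cong (λ n → n C m ℕ.+ (l ℕ.+ suc m) C suc m) (sym (ℕ.+-suc l m)))
      (nCk+nC[k+1]≡[n+1]C[k+1] (l ℕ.+ suc m) m)))

-- Pascal's rule for C(l + m, l). At l = m = 0 the left side would be 2, whence the positivity of l.
multichoose-+ : ∀ l m → 0 < l → multichoose l m ℕ.+ multichoose m l ≡ (l ℕ.+ m) C l
multichoose-+ (suc l) zero    _ = trans (ℕ.+-identityʳ _) (trans (multichoose-zeroʳ l)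
  (sym (trans (cong (_C suc l) (ℕ.+-identityʳ (suc l))) (nCn≡1 (suc l)))))
multichoose-+ l       (suc m) _ = begin
  multichoose l (suc m) ℕ.+ multichoose (suc m) l ≡⟨ cong (multichoose l (suc m) ℕ.+_) (multichoose-suc-comm m l) ⟩
  multichoose (suc l) (suc m)                     ≡⟨ multichoose-suc≡C l (suc m) ⟩
  (l ℕ.+ suc m) C suc m                           ≡⟨ nCk≡nC[n∸k] (ℕ.m≤n+m (suc m) l) ⟩
  (l ℕ.+ suc m) C (l ℕ.+ suc m ∸ suc m)           ≡⟨ cong ((l ℕ.+ suc m) C_) (ℕ.m+n∸n≡m l (suc m)) ⟩
  (l ℕ.+ suc m) C l                               ∎
  where open ≡.≡-Reasoning

-- Translation invariance yields l x = `multichoose l m` with |G| in place of l; adding m x, which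
-- `multichoose-swap` evaluates after multiplication by l, gives the Catalan form.
+-*-multichoose : ∀ l m x → 0 < l → l ℕ.* x ≡ multichoose l m → (l ℕ.+ m) ℕ.* x ≡ (l ℕ.+ m) C l
+-*-multichoose l m x 0<l lx≡ = ℕ.*-cancelˡ-≡ _ _ l {{ℕ.>-nonZero 0<l}} (begin
  l ℕ.* ((l ℕ.+ m) ℕ.* x)                               ≡⟨ left-comm l (l ℕ.+ m) x ⟩
  (l ℕ.+ m) ℕ.* (l ℕ.* x)                               ≡⟨ cong ((l ℕ.+ m) ℕ.*_) lx≡ ⟩
  (l ℕ.+ m) ℕ.* multichoose l m                         ≡⟨ ℕ.*-distribʳ-+ (multichoose l m) l m ⟩
  l ℕ.* multichoose l m ℕ.+ m ℕ.* multichoose l m       ≡⟨ cong (l ℕ.* multichoose l m ℕ.+_) (multichoose-swap l m) ⟩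
  l ℕ.* multichoose l m ℕ.+ l ℕ.* multichoose m l       ≡⟨ ℕ.*-distribˡ-+ l _ _ ⟨
  l ℕ.* (multichoose l m ℕ.+ multichoose m l)           ≡⟨ cong (l ℕ.*_) (multichoose-+ l m 0<l) ⟩
  l ℕ.* ((l ℕ.+ m) C l)                                 ∎)
  where
  open ≡.≡-Reasoning
  left-comm : ∀ i j k → i ℕ.* (j ℕ.* k) ≡ j ℕ.* (i ℕ.* k)
  left-comm i j k = trans (sym (ℕ.*-assoc i j k)) (trans (cong (ℕ._* k) (ℕ.*-comm i j)) (ℕ.*-assoc j i k))

-- Divisor sums and Möbius inversion

∑-filter : ∀ {P : A → Set p} (P? : ∀ x → Dec (P x)) xs F → ∑ (filter P? xs) F ≡ ∑ xs (λ x → 𝟙 (P? x) ℤ.* F x)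
∑-filter P? []       F = refl
∑-filter P? (x ∷ xs) F with P? x
... | yes _ = cong₂ ℤ._+_ (sym (ℤ.*-identityˡ (F x))) (∑-filter P? xs F)
... | no  _ = trans (∑-filter P? xs F) (sym (ℤ.+-identityˡ _))

-- Listed downwards, so that n stands first among its divisors and `divisors-suc` is a single step
-- of the filter.
properDivisors divisors : ℕ → List ℕ
properDivisors n = filter (_∣? n) (map suc (downFrom (ℕ.pred n)))
divisors       n = filter (_∣? n) (map suc (downFrom n))

divisors-suc : ∀ n → divisors (suc n) ≡ suc n ∷ properDivisors (suc n)
divisors-suc n = List.filter-accept (_∣? suc n) ∣-refl

∈-properDivisors⁻ : ∀ {n d} → d ∈ properDivisors n → 0 < d × d < n × d ∣ n
∈-properDivisors⁻ {suc n} d∈ with d∈′ , d∣n ← ∈-filter⁻ (_∣? suc n) {xs = map suc (downFrom n)} d∈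
                             with i , i∈ , refl ← ∈-map⁻ suc d∈′ =
  ℕ.z<s , ℕ.s<s (∈-downFrom⁻ i∈) , d∣n

∈-divisors⁻ : ∀ {n d} → d ∈ divisors n → 0 < d × d ∣ n
∈-divisors⁻ {n} d∈ with d∈′ , d∣n ← ∈-filter⁻ (_∣? n) {xs = map suc (downFrom n)} d∈
                       with i , i∈ , refl ← ∈-map⁻ suc d∈′ = ℕ.z<s , d∣n

∈-divisors⁺ : ∀ {n d} → 0 < n → d ∣ n → d ∈ divisors n
∈-divisors⁺ {n}     {zero}  0<n d∣n = contradiction (sym (0∣⇒≡0 d∣n)) (ℕ.<⇒≢ 0<n)
∈-divisors⁺ {suc n} {suc d} 0<n d∣n = ∈-filter⁺ (_∣? suc n) (∈-map⁺ suc (∈-downFrom⁺ (∣⇒≤ d∣n))) d∣n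

divisors-unique : ∀ n → UniqueSetoid.Unique (≡.setoid ℕ) (divisors n)
divisors-unique n = Unique.filter⁺ (_∣? n) (Unique.map⁺ ℕ.suc-injective (Unique.downFrom⁺ n))

0<gcd : ∀ k n → 0 < n → 0 < gcd k n
0<gcd k n 0<n = ℕ.n≢0⇒n>0 λ gcd≡0 → ℕ.<⇒≢ 0<n (sym (0∣⇒≡0 (subst (_∣ n) gcd≡0 (gcd[m,n]∣n k n))))

-- A divisor of n divides k exactly when it divides gcd(k, n). The indicator form is the one in
-- which the orthogonality of characters and the restriction to common divisors appear.
∑-divisors-gcd : ∀ k n → 0 < n → ∀ F → ∑ (divisors (gcd k n)) F ≡ ∑ (divisors n) (λ d → 𝟙 (d ∣? k) ℤ.* F d)
∑-divisors-gcd k n 0<n F = trans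
  (∑-↭ (≡.setoid ℕ) F (cong F) (unique⇒↭ (≡.setoid ℕ) (divisors-unique (gcd k n))
    (Unique.filter⁺ (_∣? k) (divisors-unique n))
    (λ d∈ → let _ , d∣gcd = ∈-divisors⁻ {gcd k n} d∈ in
      ∈-filter⁺ (_∣? k) (∈-divisors⁺ 0<n (∣-trans d∣gcd (gcd[m,n]∣n k n))) (∣-trans d∣gcd (gcd[m,n]∣m k n)))
    (λ d∈ → let d∈n , d∣k = ∈-filter⁻ (_∣? k) {xs = divisors n} d∈ in
      ∈-divisors⁺ (0<gcd k n 0<n) (gcd-greatest d∣k (proj₂ (∈-divisors⁻ {n} d∈n))))))
  (∑-filter (_∣? k) (divisors n) F)

-- Möbius inversion; the first argument is fuel for the recursion over proper divisors, of which d suffices.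
invertWithin : ℕ → (ℕ → ℤ) → ℕ → ℤ
invertWithin zero    u d = 0ℤ
invertWithin (suc f) u d = u d ℤ.- ∑ (properDivisors d) (invertWithin f u)

invert : (ℕ → ℤ) → ℕ → ℤ
invert u d = invertWithin d u d

-- In `invert u d` the values at proper divisors e are computed with fuel d - 1, while `invert u e`
-- starts with fuel e.
invertWithin-stable : ∀ u f f′ {d} → 0 < d → d ℕ.≤ f → d ℕ.≤ f′ → invertWithin f u d ≡ invertWithin f′ u d
invertWithin-stable u zero    f′       0<d d≤f d≤f′ = contradiction (ℕ.≤-trans 0<d d≤f) λ ()
invertWithin-stable u (suc f) zero     0<d d≤f d≤f′ = contradiction (ℕ.≤-trans 0<d d≤f′) λ ()
invertWithin-stable u (suc f) (suc f′) {d} 0<d d≤f d≤f′ = cong (λ z → u d ℤ.- z)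
  (∑-cong-∈ (properDivisors d) λ e∈ → let 0<e , e<d , _ = ∈-properDivisors⁻ {d} e∈ in
    invertWithin-stable u f f′ 0<e (ℕ.≤-pred (ℕ.≤-trans e<d d≤f)) (ℕ.≤-pred (ℕ.≤-trans e<d d≤f′)))

∑-divisors-invert : ∀ u d → 0 < d → ∑ (divisors d) (invert u) ≡ u d
∑-divisors-invert u (suc d) _ = begin
  ∑ (divisors (suc d)) (invert u)
    ≡⟨ cong (λ ds → ∑ ds (invert u)) (divisors-suc d) ⟩
  invert u (suc d) ℤ.+ ∑ (properDivisors (suc d)) (invert u)
    ≡⟨ cong (λ z → u (suc d) ℤ.- z ℤ.+ ∑ (properDivisors (suc d)) (invert u)) (∑-cong-∈ (properDivisors (suc d)) λ {e} e∈ →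
         let 0<e , e<d , _ = ∈-properDivisors⁻ {suc d} e∈ in
         invertWithin-stable u d e 0<e (ℕ.≤-pred e<d) ℕ.≤-refl) ⟩
  u (suc d) ℤ.- ∑ (properDivisors (suc d)) (invert u) ℤ.+ ∑ (properDivisors (suc d)) (invert u)
    ≡⟨ cancel (u (suc d)) _ ⟩
  u (suc d) ∎
  where
  open ≡.≡-Reasoning
  cancel : ∀ i j → i ℤ.- j ℤ.+ j ≡ i
  cancel = solve-∀

-- Strong induction: the sum over the divisors of d determines the value at d once the values at
-- proper divisors agree. Identities between Möbius inverses can thus be checked on the summed
-- functions, without the Möbius function.
∑-divisors-injective : ∀ n (F F′ : ℕ → ℤ) → (∀ d → 0 < d → d ∣ n → ∑ (divisors d) F ≡ ∑ (divisors d) F′) →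
                       ∀ d → 0 < d → d ∣ n → F d ≡ F′ d
∑-divisors-injective n F F′ sums = <-rec _ λ
  { (suc d) rec 0<d d∣n → +-cancelʳ (∑ (properDivisors (suc d)) F) _ _ (trans
      (trans (cong (λ ds → ∑ ds F) (sym (divisors-suc d))) 
        (trans (sums (suc d) 0<d d∣n) (cong (λ ds → ∑ ds F′) (divisors-suc d))))
      (cong (λ z → F′ (suc d) ℤ.+ z) (sym (∑-cong-∈ (properDivisors (suc d)) λ e∈ →
        let 0<e , e<d , e∣d = ∈-properDivisors⁻ {suc d} e∈ in rec e<d 0<e (∣-trans e∣d d∣n))))) }

invert-cong : ∀ n {u u′} → (∀ d → 0 < d → d ∣ n → u d ≡ u′ d) → ∀ d → 0 < d → d ∣ n → invert u d ≡ invert u′ d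
invert-cong n {u} {u′} u≗u′ = ∑-divisors-injective n (invert u) (invert u′) λ d 0<d d∣n →
  trans (∑-divisors-invert u d 0<d) (trans (u≗u′ d 0<d d∣n) (sym (∑-divisors-invert u′ d 0<d)))

-- Coefficients of (1 − xᵈ)^(−g/d)

∑-downFrom-suc : ∀ n F → ∑ (downFrom (suc n)) F ≡ F 0 ℤ.+ ∑ (downFrom n) (F ∘ suc)
∑-downFrom-suc zero    F = refl
∑-downFrom-suc (suc n) F = trans (cong (λ z → F (suc n) ℤ.+ z) (∑-downFrom-suc n F)) (+-left-comm (F (suc n)) (F 0) _)

*-cong-middle : ∀ w x y z d → w ℕ.* x ≡ y ℕ.* z → w ℕ.* d ℕ.* x ≡ y ℕ.* d ℕ.* z
*-cong-middle w x y z d eq = trans (swap-middle w x) (trans (cong (ℕ._* d) eq) (sym (swap-middle y z)))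
  where
  swap-middle : ∀ i j → i ℕ.* d ℕ.* j ≡ i ℕ.* j ℕ.* d
  swap-middle i j = trans (ℕ.*-assoc i d j) (trans (cong (i ℕ.*_) (ℕ.*-comm d j)) (sym (ℕ.*-assoc i j d)))

-- The coefficient of xᵐ in (1 − xᵈ)^(−g/d); it is 0 unless d divides g and m.
coefficient : ℕ → ℕ → ℕ → ℤ
coefficient g d m with d ∣? g | d ∣? m
... | yes (divides l _) | yes (divides q _) = + multichoose l q
... | yes _             | no  _             = 0ℤ
... | no  _             | _                 = 0ℤ

coefficient-* : ∀ l q d .{{_ : ℕ.NonZero d}} → coefficient (l ℕ.* d) d (q ℕ.* d) ≡ + multichoose l q
coefficient-* l q d with d ∣? l ℕ.* d | d ∣? q ℕ.* d
... | yes (divides l′ l≡) | yes (divides q′ q≡) =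
  cong₂ (λ l q → + multichoose l q) (ℕ.*-cancelʳ-≡ l′ l d (sym l≡)) (ℕ.*-cancelʳ-≡ q′ q d (sym q≡))
... | yes _               | no  ∤               = contradiction (n∣m*n q) ∤
... | no  ∤               | _                   = contradiction (n∣m*n l) ∤

coefficient-∤ : ∀ g d m → ¬ d ∣ m → coefficient g d m ≡ 0ℤ
coefficient-∤ g d m ∤ with d ∣? g | d ∣? m
... | yes _ | yes d∣m = contradiction d∣m ∤
... | yes _ | no  _ = refl
... | no  _ | _     = refl

-- With g = l d and m = q d this is `multichoose-swap` for l and q, multiplied by d; if d fails to
-- divide g or m, both coefficients vanish.
coefficient-swap : ∀ g d m → + m ℤ.* coefficient g d m ≡ + g ℤ.* coefficient m d g
coefficient-swap g d m with d ∣? g | d ∣? m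
... | yes (divides l refl) | yes (divides q refl) = trans (sym (ℤ.pos-* (q ℕ.* d) _))
  (trans (cong +_ (*-cong-middle q (multichoose l q) l (multichoose q l) d (multichoose-swap l q))) (ℤ.pos-* (l ℕ.* d) _))
... | yes _ | no  _ = trans (ℤ.*-zeroʳ (+ m)) (sym (ℤ.*-zeroʳ (+ g)))
... | no  _ | yes _ = trans (ℤ.*-zeroʳ (+ m)) (sym (ℤ.*-zeroʳ (+ g)))
... | no  _ | no  _ = trans (ℤ.*-zeroʳ (+ m)) (sym (ℤ.*-zeroʳ (+ g)))

coefficient-zero : ∀ g d .{{_ : ℕ.NonZero d}} → d ∣ g → coefficient g d 0 ≡ 1ℤ
coefficient-zero .(l ℕ.* d) d (divides l refl) = trans (coefficient-* l 0 d) (cong +_ (multichoose-zeroʳ l))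

module _ (l d : ℕ) .{{_ : ℕ.NonZero d}} where
  -- The coefficient of xᵐ in xᵈ / (1 - xᵈ) times (1 - xᵈ)^(-l), that is, in xᵈ (1 - xᵈ)^(-l-1); the
  -- index k stands for the exponent k + 1 in the first factor.
  stepSum : ℕ → ℤ
  stepSum m = ∑ (downFrom m) (λ k → 𝟙 (d ∣? suc k) ℤ.* coefficient (l ℕ.* d) d (m ∸ suc k))

  stepSum-∤ : ∀ m → ¬ d ∣ m → stepSum m ≡ 0ℤ
  stepSum-∤ m ∤ = ∑-zero (downFrom m) λ {k} k∈ → vanish k (∈-downFrom⁻ k∈)
    where
    vanish : ∀ k → k < m → 𝟙 (d ∣? suc k) ℤ.* coefficient (l ℕ.* d) d (m ∸ suc k) ≡ 0ℤ
    vanish k k<m with d ∣? suc k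
    ... | yes d∣k = trans (ℤ.*-identityˡ _) (coefficient-∤ _ d _ λ d∣ → ∤ (∣m∸n∣n⇒∣m d k<m d∣ d∣k))
    ... | no  _   = refl

  -- The terms with k ≥ d reproduce `stepSum m` after a shift by d; among the other d terms only k +
  -- 1 = d is a multiple of d.
  stepSum-+ : ∀ m → stepSum (m ℕ.+ d) ≡ stepSum m ℤ.+ coefficient (l ℕ.* d) d m
  stepSum-+ m = trans (∑-downFrom-+ m d _) (cong₂ ℤ._+_
    (∑-cong (downFrom m) λ k → cong₂ (λ x n → x ℤ.* coefficient (l ℕ.* d) d n)
      (𝟙-cong (d ∣? suc (k ℕ.+ d)) (d ∣? suc k)
        (λ d∣ → ∣m+n∣m⇒∣n (subst (d ∣_) (ℕ.+-comm (suc k) d) d∣) ∣-refl) (λ d∣ → ∣m∣n⇒∣m+n d∣ ∣-refl))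
      (trans (cong₂ _∸_ (ℕ.+-comm m d) (ℕ.+-comm (suc k) d)) (ℕ.[m+n]∸[m+o]≡n∸o d m (suc k))))
    (last d refl))
    where
    -- e is kept apart from the module parameter d so that the top index d - 1 can be split off by
    -- matching.
    last : ∀ e → e ≡ d → ∑ (downFrom e) (λ k → 𝟙 (d ∣? suc k) ℤ.* coefficient (l ℕ.* d) d (m ℕ.+ d ∸ suc k)) ≡
                       coefficient (l ℕ.* d) d m
    last zero    e≡ = contradiction (sym e≡) (ℕ.≢-nonZero⁻¹ d)
    last (suc e) e≡ = trans (cong₂ ℤ._+_
        (trans (cong₂ (λ x n → x ℤ.* coefficient (l ℕ.* d) d n)
                 (𝟙-yes (d ∣? suc e) (subst (d ∣_) (sym e≡) ∣-refl))
                 (trans (cong (m ℕ.+ d ∸_) e≡) (ℕ.m+n∸n≡m m d)))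
               (ℤ.*-identityˡ _))
        (∑-zero (downFrom e) λ {k} k∈ → cong (λ z → z ℤ.* coefficient (l ℕ.* d) d (m ℕ.+ d ∸ suc k)) (𝟙-no (d ∣? suc k) λ d∣ →
          ℕ.<⇒≱ (subst (suc k <_) e≡ (ℕ.s<s (∈-downFrom⁻ k∈))) (∣⇒≤ d∣))))
      (ℤ.+-identityʳ _)

  stepSum-multiple : ∀ q → stepSum (suc q ℕ.* d) ≡ + multichoose (suc l) q
  stepSum-multiple q = trans (cong stepSum (ℕ.+-comm d (q ℕ.* d))) (trans (stepSum-+ (q ℕ.* d)) (step q))
    where
    step : ∀ q → stepSum (q ℕ.* d) ℤ.+ coefficient (l ℕ.* d) d (q ℕ.* d) ≡ + multichoose (suc l) q
    step zero    = trans (ℤ.+-identityˡ _) (coefficient-* l 0 d)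
    step (suc q) = trans (cong₂ ℤ._+_ (stepSum-multiple q) (coefficient-* l (suc q) d))
      (cong +_ (ℕ.+-comm (multichoose (suc l) q) _))

  -- The coefficient of xᵐ in x f′ = g f xᵈ / (1 - xᵈ) for f = (1 - xᵈ)^(-g/d), where g = l d.
  -- Newton's identity gives the component at d the same recurrence.
  coefficient-recurrence : ∀ m → + m ℤ.* coefficient (l ℕ.* d) d m ≡ + (l ℕ.* d) ℤ.* stepSum m
  coefficient-recurrence m = go m (d ∣? m)
    where
    open ≡.≡-Reasoning
    go : ∀ m → Dec (d ∣ m) → + m ℤ.* coefficient (l ℕ.* d) d m ≡ + (l ℕ.* d) ℤ.* stepSum m
    go m (no ∤) = trans (cong (λ z → + m ℤ.* z) (coefficient-∤ (l ℕ.* d) d m ∤)) (trans (ℤ.*-zeroʳ (+ m))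
      (sym (trans (cong (λ z → + (l ℕ.* d) ℤ.* z) (stepSum-∤ m ∤)) (ℤ.*-zeroʳ (+ (l ℕ.* d))))))
    go m (yes (divides zero    refl)) = sym (ℤ.*-zeroʳ (+ (l ℕ.* d)))
    go m (yes (divides (suc q) refl)) = begin
      + (suc q ℕ.* d) ℤ.* coefficient (l ℕ.* d) d (suc q ℕ.* d)
        ≡⟨ cong (λ z → + (suc q ℕ.* d) ℤ.* z) (coefficient-* l (suc q) d) ⟩
      + (suc q ℕ.* d) ℤ.* + multichoose l (suc q)
        ≡⟨ ℤ.pos-* (suc q ℕ.* d) _ ⟨
      + (suc q ℕ.* d ℕ.* multichoose l (suc q))
        ≡⟨ cong +_ (*-cong-middle (suc q) (multichoose l (suc q)) l (multichoose (suc l) q) d (multichoose-suc l q)) ⟩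
      + (l ℕ.* d ℕ.* multichoose (suc l) q)
        ≡⟨ ℤ.pos-* (l ℕ.* d) _ ⟩
      + (l ℕ.* d) ℤ.* + multichoose (suc l) q
        ≡⟨ cong (λ z → + (l ℕ.* d) ℤ.* z) (stepSum-multiple q) ⟨
      + (l ℕ.* d) ℤ.* stepSum (suc q ℕ.* d) ∎

coefficient-step : ∀ {g d} → 0 < d → d ∣ g → ∀ m → + m ℤ.* coefficient g d m ≡
                   + g ℤ.* ∑ (downFrom m) (λ k → 𝟙 (d ∣? suc k) ℤ.* coefficient g d (m ∸ suc k))
coefficient-step {d = suc d} _ (divides l refl) m = coefficient-recurrence l (suc d) m

-- Sums over residues modulo n and over boxes

residues-unique : ∀ e x {i j} → i < e → j < e → + e ∣ℤ x ℤ.- + i → + e ∣ℤ x ℤ.- + j → i ≡ j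
residues-unique e x {i} {j} i<e j<e e∣x-i e∣x-j = ℤ.+-injective (ℤ.i-j≡0⇒i≡j (+ i) (+ j)
  (ℤ.∣i∣≡0⇒i≡0 (small (ℤ.∣⇒∣ᵤ (subst (+ e ∣ℤ_) (difference x (+ i) (+ j)) (ℤ.∣m∣n⇒∣m-n e∣x-j e∣x-i))))))
  where
  difference : ∀ x i j → (x ℤ.- j) ℤ.- (x ℤ.- i) ≡ i ℤ.- j
  difference = solve-∀

  bound : ℤ.∣ + i ℤ.- + j ∣ < e
  bound = ℕ.≤-<-trans (subst (λ z → ℤ.∣ z ∣ ℕ.≤ i ℕ.⊔ j) (sym (ℤ.m-n≡m⊖n i j)) (ℤ.∣m⊝n∣≤m⊔n i j)) (ℕ.⊔-lub i<e j<e)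

  small : e ∣ ℤ.∣ + i ℤ.- + j ∣ → ℤ.∣ + i ℤ.- + j ∣ ≡ 0
  small e∣ = go _ refl
    where
    go : ∀ n → ℤ.∣ + i ℤ.- + j ∣ ≡ n → ℤ.∣ + i ℤ.- + j ∣ ≡ 0
    go zero    eq = eq
    go (suc n) eq = contradiction (subst (e ℕ.≤_) (sym eq) (∣⇒≤ (subst (e ∣_) eq e∣))) (ℕ.<⇒≱ bound)

∑-residues : ∀ e .{{_ : ℕ.NonZero e}} x → ∑ (downFrom e) (λ i → 𝟙 (+ e ∣ℤ? x ℤ.- + i)) ≡ 1ℤ
∑-residues e x = ∑-downFrom-𝟙-unique (λ i → + e ∣ℤ? x ℤ.- + i) e (n%ℕd<d x e) e∣x-r
  λ j<e e∣x-j → residues-unique e x j<e (n%ℕd<d x e) e∣x-j e∣x-r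
  where
  cancel : ∀ r q → r ℤ.+ q ℤ.- r ≡ q
  cancel = solve-∀
  e∣x-r : + e ∣ℤ x ℤ.- + (x %ℕ e)
  e∣x-r = ℤ.divides (x /ℕ e) (trans (cong (λ z → z ℤ.- + (x %ℕ e)) (a≡a%ℕn+[a/ℕn]*n x e)) (cancel (+ (x %ℕ e)) _))

-- The range splits into q blocks of e consecutive integers, each of which meets the residue class
-- of x once.
∑-residues-* : ∀ q e .{{_ : ℕ.NonZero e}} x → ∑ (downFrom (q ℕ.* e)) (λ i → 𝟙 (+ e ∣ℤ? x ℤ.- + i)) ≡ + q
∑-residues-* zero    e x = refl
∑-residues-* (suc q) e x = trans (∑-downFrom-+ e (q ℕ.* e) _) (cong₂ ℤ._+_
  (trans (∑-cong (downFrom e) λ i → cong (λ z → 𝟙 (+ e ∣ℤ? z)) (shift x (+ i) (+ (q ℕ.* e)))) (∑-residues e (x ℤ.- + (q ℕ.* e))))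
  (∑-residues-* q e x))
  where
  shift : ∀ x i j → x ℤ.- (i ℤ.+ j) ≡ x ℤ.- j ℤ.- i
  shift = solve-∀

bézout : ∀ k d → ∃[ α ] ∃[ β ] (+ gcd k d ≡ α ℤ.* + k ℤ.+ β ℤ.* + d)
bézout k d with Bézout.identity (gcd-GCD k d)
... | Bézout.+- x y eq = + x , ℤ.- (+ y) , (begin
  + gcd k d                                          ≡⟨ add-cancel (+ gcd k d) (+ y) (+ d) ⟩
  + gcd k d ℤ.+ + y ℤ.* + d ℤ.+ ℤ.- (+ y) ℤ.* + d    ≡⟨ cong (λ z → + gcd k d ℤ.+ z ℤ.+ ℤ.- (+ y) ℤ.* + d) (ℤ.pos-* y d) ⟨
  + (gcd k d ℕ.+ y ℕ.* d) ℤ.+ ℤ.- (+ y) ℤ.* + d      ≡⟨ cong (λ z → z ℤ.+ ℤ.- (+ y) ℤ.* + d) (trans (cong +_ eq) (ℤ.pos-* x k)) ⟩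
  + x ℤ.* + k ℤ.+ ℤ.- (+ y) ℤ.* + d                  ∎)
  where
  open ≡.≡-Reasoning
  add-cancel : ∀ g y d → g ≡ g ℤ.+ y ℤ.* d ℤ.+ ℤ.- y ℤ.* d
  add-cancel = solve-∀
... | Bézout.-+ x y eq = ℤ.- (+ x) , + y , (begin
  + gcd k d                                          ≡⟨ add-cancel (+ gcd k d) (+ x) (+ k) ⟩
  ℤ.- (+ x) ℤ.* + k ℤ.+ (+ gcd k d ℤ.+ + x ℤ.* + k)  ≡⟨ cong (λ z → ℤ.- (+ x) ℤ.* + k ℤ.+ (+ gcd k d ℤ.+ z)) (ℤ.pos-* x k) ⟨
  ℤ.- (+ x) ℤ.* + k ℤ.+ + (gcd k d ℕ.+ x ℕ.* k)      ≡⟨ cong (λ z → ℤ.- (+ x) ℤ.* + k ℤ.+ z) (trans (cong +_ eq) (ℤ.pos-* y d)) ⟩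
  ℤ.- (+ x) ℤ.* + k ℤ.+ + y ℤ.* + d                  ∎)
  where
  open ≡.≡-Reasoning
  add-cancel : ∀ g x k → g ≡ ℤ.- x ℤ.* k ℤ.+ (g ℤ.+ x ℤ.* k)
  add-cancel = solve-∀

-- For d ∣ n, the sum at x of the characters of Cₙ whose order divides d: these are x ↦ ζˣ for the
-- d-th roots of unity ζ.
weight : ℕ → ℤ → ℤ
weight d x = + d ℤ.* 𝟙 (+ d ∣ℤ? x)

-- For h = gcd(k, d) dividing x, Bézout turns d ∣ x − kz into e ∣ t − z with e = d / h,
-- which holds for n / e residues z mod n.
∑-weight : ∀ n k d → 0 < d → d ∣ n → ∀ x →
           ∑ (downFrom n) (λ z → weight d (x ℤ.- + k ℤ.* + z)) ≡ + n ℤ.* weight (gcd k d) x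
∑-weight n k d 0<d d∣n x = trans (sym (*-distribˡ-∑ (+ d) (downFrom n) _))
  (go (+ gcd k d ∣ℤ? x) d∣n (gcd[m,n]∣n k d) (gcd[m,n]∣m k d) (bézout k d))
  where
  h = gcd k d

  go : Dec (+ h ∣ℤ x) → d ∣ n → h ∣ d → h ∣ k → (∃[ α ] ∃[ β ] (+ h ≡ α ℤ.* + k ℤ.+ β ℤ.* + d)) →
       + d ℤ.* ∑ (downFrom n) (λ z → 𝟙 (+ d ∣ℤ? x ℤ.- + k ℤ.* + z)) ≡ + n ℤ.* weight h x
  -- h divides d and k, so a single z with d ∣ x - kz would force h ∣ x.
  go (no h∤x) _ h∣d h∣k _ = trans (trans (cong (λ z → + d ℤ.* z) (∑-zero (downFrom n) λ {z} _ →
      𝟙-no (+ d ∣ℤ? x ℤ.- + k ℤ.* + z) λ d∣ →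
      h∤x (ℤ.∣m+n∣n⇒∣m (ℤ.∣-trans (ℤ.∣ᵤ⇒∣ h∣d) d∣) (ℤ.∣m⇒∣-m (ℤ.∣m⇒∣m*n {m = + k} (+ z) (ℤ.∣ᵤ⇒∣ h∣k))))))
      (ℤ.*-zeroʳ (+ d)))
    (sym (trans (cong (λ z → + n ℤ.* (+ h ℤ.* z)) (𝟙-no (+ h ∣ℤ? x) h∤x))
      (trans (cong (λ z → + n ℤ.* z) (ℤ.*-zeroʳ (+ h))) (ℤ.*-zeroʳ (+ n)))))
  go (yes h∣x@(ℤ.divides x′ x≡x′h)) (divides q n≡qd) (divides e d≡eh) (divides k′ k≡k′h) (α , β , h≡) = begin
    + d ℤ.* ∑ (downFrom n) (λ z → 𝟙 (+ d ∣ℤ? x ℤ.- + k ℤ.* + z))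
      ≡⟨ cong (λ z → + d ℤ.* z) (∑-cong (downFrom n) λ z →
           𝟙-cong (+ d ∣ℤ? x ℤ.- + k ℤ.* + z) (+ e ∣ℤ? α ℤ.* x′ ℤ.- + z) (reduce z) (unreduce z)) ⟩
    + d ℤ.* ∑ (downFrom n) (λ z → 𝟙 (+ e ∣ℤ? α ℤ.* x′ ℤ.- + z))
      ≡⟨ cong (λ m → + d ℤ.* ∑ (downFrom m) (λ z → 𝟙 (+ e ∣ℤ? α ℤ.* x′ ℤ.- + z))) n≡qhe ⟩
    + d ℤ.* ∑ (downFrom (q ℕ.* h ℕ.* e)) (λ z → 𝟙 (+ e ∣ℤ? α ℤ.* x′ ℤ.- + z))
      ≡⟨ cong (λ z → + d ℤ.* z) (∑-residues-* (q ℕ.* h) e {{e≢0}} (α ℤ.* x′)) ⟩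
    + d ℤ.* + (q ℕ.* h)
      ≡⟨ trans (sym (ℤ.pos-* d (q ℕ.* h))) (trans (cong +_ dqh≡nh) (ℤ.pos-* n h)) ⟩
    + n ℤ.* + h
      ≡⟨ cong (λ z → + n ℤ.* z) (trans (sym (ℤ.*-identityʳ (+ h))) (cong (λ z → + h ℤ.* z) (sym (𝟙-yes (+ h ∣ℤ? x) h∣x)))) ⟩
    + n ℤ.* weight h x ∎
    where
    open ≡.≡-Reasoning

    e≢0 : ℕ.NonZero e
    e≢0 = ℕ.≢-nonZero λ e≡0 → ℕ.<⇒≢ 0<d (sym (trans d≡eh (cong (ℕ._* h) e≡0)))

    h≢0 : ℕ.NonZero h
    h≢0 = ℕ.≢-nonZero λ h≡0 → ℕ.<⇒≢ 0<d (sym (trans d≡eh (trans (cong (e ℕ.*_) h≡0) (ℕ.*-zeroʳ e))))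

    n≡qhe : n ≡ q ℕ.* h ℕ.* e
    n≡qhe = trans n≡qd (trans (cong (q ℕ.*_) (trans d≡eh (ℕ.*-comm e h))) (sym (ℕ.*-assoc q h e)))

    dqh≡nh : d ℕ.* (q ℕ.* h) ≡ n ℕ.* h
    dqh≡nh = trans (sym (ℕ.*-assoc d q h)) (cong (ℕ._* h) (trans (ℕ.*-comm d q) (sym n≡qd)))

    +d≡eh : + d ≡ + e ℤ.* + h
    +d≡eh = trans (cong +_ d≡eh) (ℤ.pos-* e h)

    x-kz : ∀ z → x ℤ.- + k ℤ.* z ≡ + k ℤ.* (α ℤ.* x′ ℤ.- z) ℤ.+ β ℤ.* x′ ℤ.* + d
    x-kz z = trans (cong (λ y → y ℤ.- + k ℤ.* z) (trans x≡x′h (cong (λ y → x′ ℤ.* y) h≡))) (expand x′ α β (+ k) (+ d) z)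
      where
      expand : ∀ x′ α β k d z → x′ ℤ.* (α ℤ.* k ℤ.+ β ℤ.* d) ℤ.- k ℤ.* z ≡ k ℤ.* (α ℤ.* x′ ℤ.- z) ℤ.+ β ℤ.* x′ ℤ.* d
      expand = solve-∀

    -- With w = αx′ - z the hypothesis amounts to d ∣ kw; hence d divides αkw + βdw = hw, and h
    -- cancels from d = eh.
    reduce : ∀ z → + d ∣ℤ x ℤ.- + k ℤ.* + z → + e ∣ℤ α ℤ.* x′ ℤ.- + z
    reduce z d∣ = ℤ.*-cancelʳ-∣ (+ h) {{h≢0}} (subst₂ _∣ℤ_ +d≡eh
      (sym (trans (cong (λ y → (α ℤ.* x′ ℤ.- + z) ℤ.* y) h≡) (expand (α ℤ.* x′ ℤ.- + z) α β (+ k) (+ d))))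
      (ℤ.∣m∣n⇒∣m+n (ℤ.∣n⇒∣m*n α (ℤ.∣m+n∣n⇒∣m (subst (+ d ∣ℤ_) (x-kz (+ z)) d∣) (ℤ.∣n⇒∣m*n (β ℤ.* x′) ℤ.∣-refl)))
                   (ℤ.∣n⇒∣m*n (β ℤ.* (α ℤ.* x′ ℤ.- + z)) ℤ.∣-refl)))
      where
      expand : ∀ w α β k d → w ℤ.* (α ℤ.* k ℤ.+ β ℤ.* d) ≡ α ℤ.* (k ℤ.* w) ℤ.+ β ℤ.* w ℤ.* d
      expand = solve-∀

    -- Conversely, e ∣ w and h ∣ k give d = eh ∣ kw.
    unreduce : ∀ z → + e ∣ℤ α ℤ.* x′ ℤ.- + z → + d ∣ℤ x ℤ.- + k ℤ.* + z
    unreduce z (ℤ.divides c eq) = subst (+ d ∣ℤ_) (sym (x-kz (+ z))) (ℤ.∣m∣n⇒∣m+n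
      (ℤ.divides (+ k′ ℤ.* c) (trans (cong₂ ℤ._*_ (trans (cong +_ k≡k′h) (ℤ.pos-* k′ h)) eq)
        (trans (rearrange (+ k′) (+ h) c (+ e)) (cong (λ y → + k′ ℤ.* c ℤ.* y) (sym +d≡eh)))))
      (ℤ.∣n⇒∣m*n (β ℤ.* x′) ℤ.∣-refl))
      where
      rearrange : ∀ k h c e → k ℤ.* h ℤ.* (c ℤ.* e) ≡ k ℤ.* c ℤ.* (e ℤ.* h)
      rearrange = solve-∀

weight-cong : ∀ {n d x y} → d ∣ n → + n ∣ℤ x ℤ.- y → weight d x ≡ weight d y
weight-cong {n} {d} {x} {y} d∣n n∣x-y = cong (λ z → + d ℤ.* z) (𝟙-cong (+ d ∣ℤ? x) (+ d ∣ℤ? y)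
  (λ d∣x → ℤ.∣m+n∣m⇒∣n (subst (+ d ∣ℤ_) (restore x y) d∣x) d∣x-y)
  (λ d∣y → subst (+ d ∣ℤ_) (sym (restore x y)) (ℤ.∣m∣n⇒∣m+n d∣x-y d∣y)))
  where
  d∣x-y : + d ∣ℤ x ℤ.- y
  d∣x-y = ℤ.∣-trans (ℤ.∣ᵤ⇒∣ d∣n) n∣x-y
  restore : ∀ x y → x ≡ (x ℤ.- y) ℤ.+ y
  restore = solve-∀

-- A character of Cₙʳ is a product of characters of the coordinates, and its order divides d iff all
-- of theirs do; the sum over these characters is therefore a product.
boxWeight : ∀ r → ℕ → (Fin r → ℤ) → ℤ
boxWeight zero    d v = 1ℤ
boxWeight (suc r) d v = weight d (v zero) ℤ.* boxWeight r d (v ∘ suc)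

boxWeight-cong : ∀ r {n d x y} → d ∣ n → (∀ i → + n ∣ℤ x i ℤ.- y i) → boxWeight r d x ≡ boxWeight r d y
boxWeight-cong zero    d∣n x≈y = refl
boxWeight-cong (suc r) d∣n x≈y = cong₂ ℤ._*_ (weight-cong d∣n (x≈y zero)) (boxWeight-cong r d∣n (x≈y ∘ suc))

boxWeight-∣ : ∀ r d {v} → (∀ i → + d ∣ℤ v i) → boxWeight r d v ≡ + (d ℕ.^ r)
boxWeight-∣ zero    d d∣v = refl
boxWeight-∣ (suc r) d d∣v = trans
  (cong₂ ℤ._*_ (trans (cong (λ z → + d ℤ.* z) (𝟙-yes (+ d ∣ℤ? _) (d∣v zero))) (ℤ.*-identityʳ (+ d)))
               (boxWeight-∣ r d (d∣v ∘ suc)))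
  (sym (ℤ.pos-* d (d ℕ.^ r)))

boxWeight-∤ : ∀ r d {v} → ¬ (∀ i → + d ∣ℤ v i) → boxWeight r d v ≡ 0ℤ
boxWeight-∤ zero    d d∤v = contradiction (λ ()) d∤v
boxWeight-∤ (suc r) d {v} d∤v with + d ∣ℤ? v zero
... | yes d∣v₀ = trans (cong (λ z → + d ℤ.* 1ℤ ℤ.* z) (boxWeight-∤ r d λ d∣v → d∤v λ { zero → d∣v₀ ; (suc i) → d∣v i }))
                       (ℤ.*-zeroʳ (+ d ℤ.* 1ℤ))
... | no  _    = cong (ℤ._* boxWeight r d (v ∘ suc)) (ℤ.*-zeroʳ (+ d))

residues : ℕ → List ℤ
residues n = map +_ (downFrom n)

box : ∀ r → ℕ → List (Fin r → ℤ)
box zero    n = (λ ()) ∷ []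
box (suc r) n = cartesianProductWith _∷ᶠ_ (residues n) (box r n)

∑-cartesianProductWith : ∀ {C : Set c} (f : A → B → C) xs ys F →
                         ∑ (cartesianProductWith f xs ys) F ≡ ∑ xs (λ x → ∑ ys (λ y → F (f x y)))
∑-cartesianProductWith f []       ys F = refl
∑-cartesianProductWith f (x ∷ xs) ys F = trans (∑-++ (map (f x) ys) _ F)
  (cong₂ ℤ._+_ (∑-map (f x) ys F) (∑-cartesianProductWith f xs ys F))

∑-boxWeight : ∀ r n k d → 0 < d → d ∣ n → ∀ v →
              ∑ (box r n) (λ y → boxWeight r d (λ i → v i ℤ.- + k ℤ.* y i)) ≡ + (n ℕ.^ r) ℤ.* boxWeight r (gcd k d) v
∑-boxWeight zero    n k d 0<d d∣n v = refl
∑-boxWeight (suc r) n k d 0<d d∣n v = begin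
  ∑ (box (suc r) n) (λ y → boxWeight (suc r) d (λ i → v i ℤ.- + k ℤ.* y i))
    ≡⟨ ∑-cartesianProductWith _∷ᶠ_ (residues n) (box r n) _ ⟩
  ∑ (residues n) (λ z → ∑ (box r n) (λ y → weight d (v zero ℤ.- + k ℤ.* z) ℤ.* boxWeight r d (λ i → v (suc i) ℤ.- + k ℤ.* y i)))
    ≡⟨ ∑-cong (residues n) (λ z → trans (sym (*-distribˡ-∑ (weight d (v zero ℤ.- + k ℤ.* z)) (box r n) _))
         (cong (λ S → weight d (v zero ℤ.- + k ℤ.* z) ℤ.* S) (∑-boxWeight r n k d 0<d d∣n (v ∘ suc)))) ⟩
  ∑ (residues n) (λ z → weight d (v zero ℤ.- + k ℤ.* z) ℤ.* (+ (n ℕ.^ r) ℤ.* W))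
    ≡⟨ *-distribʳ-∑ (+ (n ℕ.^ r) ℤ.* W) (residues n) _ ⟨
  ∑ (residues n) (λ z → weight d (v zero ℤ.- + k ℤ.* z)) ℤ.* (+ (n ℕ.^ r) ℤ.* W)
    ≡⟨ cong (λ S → S ℤ.* (+ (n ℕ.^ r) ℤ.* W)) (trans (∑-map +_ (downFrom n) _) (∑-weight n k d 0<d d∣n (v zero))) ⟩
  + n ℤ.* weight (gcd k d) (v zero) ℤ.* (+ (n ℕ.^ r) ℤ.* W)
    ≡⟨ rearrange (+ n) (weight (gcd k d) (v zero)) (+ (n ℕ.^ r)) W ⟩
  + n ℤ.* + (n ℕ.^ r) ℤ.* (weight (gcd k d) (v zero) ℤ.* W)
    ≡⟨ cong (λ z → z ℤ.* (weight (gcd k d) (v zero) ℤ.* W)) (ℤ.pos-* n (n ℕ.^ r)) ⟨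
  + (n ℕ.^ suc r) ℤ.* boxWeight (suc r) (gcd k d) v ∎
  where
  open ≡.≡-Reasoning
  W = boxWeight r (gcd k d) (v ∘ suc)
  rearrange : ∀ w x y z → w ℤ.* x ℤ.* (y ℤ.* z) ≡ w ℤ.* y ℤ.* (x ℤ.* z)
  rearrange = solve-∀

length-cartesianProductWith : ∀ {C : Set c} (f : A → B → C) xs ys →
                              length (cartesianProductWith f xs ys) ≡ length xs ℕ.* length ys
length-cartesianProductWith f []       ys = refl
length-cartesianProductWith f (x ∷ xs) ys = trans (List.length-++ (map (f x) ys))
  (cong₂ ℕ._+_ (List.length-map (f x) ys) (length-cartesianProductWith f xs ys))

-- Boxes as systems of representatives of Cₙʳ

module _ (n : ℕ) where
  private
    module Cₙ = AbelianGroup (Cyclic n)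
    module Cₙʳ r = AbelianGroup (CyclicPower n r)

  residues-unique′ : UniqueSetoid.Unique Cₙ.setoid (residues n)
  residues-unique′ = subst (UniqueSetoid.Unique Cₙ.setoid) (sym (List.map-downFrom +_ n))
    (AllPairsₚ.applyDownFrom⁺₁ +_ n λ {i} {j} j<i i<n i≈j →
      ℕ.<⇒≢ j<i (residues-unique n (+ i) (ℕ.<-trans j<i i<n) i<n i≈j (Cₙ.refl {+ i})))

  ∈-residues : .{{_ : ℕ.NonZero n}} → ∀ x → SetoidMembership._∈_ Cₙ.setoid x (residues n)
  ∈-residues x = Anyₚ.map⁺ (Any.map (λ { refl → ℤ.divides (x /ℕ n)
      (trans (cong (λ z → z ℤ.- + (x %ℕ n)) (a≡a%ℕn+[a/ℕn]*n x n)) (cancel (+ (x %ℕ n)) _)) })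
    (∈-downFrom⁺ (n%ℕd<d x n)))
    where
    cancel : ∀ r q → r ℤ.+ q ℤ.- r ≡ q
    cancel = solve-∀

  box-unique : ∀ r → UniqueSetoid.Unique (Cₙʳ.setoid r) (box r n)
  box-unique zero    = [] ∷ []
  box-unique (suc r) = UniqueSetoidₚ.cartesianProductWith⁺ Cₙ.setoid (Cₙʳ.setoid r) (Cₙʳ.setoid (suc r)) _∷ᶠ_
    (λ eq → eq zero , eq ∘ suc) residues-unique′ (box-unique r)

  ∈-box : .{{_ : ℕ.NonZero n}} → ∀ r v → SetoidMembership._∈_ (Cₙʳ.setoid r) v (box r n)
  ∈-box zero    v = here λ ()
  ∈-box (suc r) v = SetoidMembershipₚ.∈-resp-≈ (Cₙʳ.setoid (suc r)) {x = v zero ∷ᶠ (v ∘ suc)} {v}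
    (λ { zero → Cₙ.refl {v zero} ; (suc i) → Cₙ.refl {v (suc i)} })
    (SetoidMembershipₚ.∈-cartesianProductWith⁺ Cₙ.setoid (Cₙʳ.setoid r) (Cₙʳ.setoid (suc r))
      (λ { x≈y v≈w zero → x≈y ; x≈y v≈w (suc i) → v≈w i }) (∈-residues (v zero)) (∈-box r (v ∘ suc)))

  length-box : ∀ r → length (box r n) ≡ n ℕ.^ r
  length-box zero    = refl
  length-box (suc r) = trans (length-cartesianProductWith _∷ᶠ_ (residues n) (box r n))
    (cong₂ ℕ._*_ (trans (List.length-map +_ (downFrom n)) (List.length-downFrom n)) (length-box r))

-- The cycle lemma

#east #north : List Step → ℕ
#east []          = 0
#east (east ∷ p)  = suc (#east p)
#east (north ∷ p) = #east p
#north []          = 0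
#north (east ∷ p)  = #north p
#north (north ∷ p) = suc (#north p)

record IsWord (a b : ℕ) (w : List Step) : Set where
  constructor _,_
  field
    easts  : #east w ≡ a
    norths : #north w ≡ b

open IsWord

foldl-move : ∀ x y p → foldl move (x , y) p ≡ (#east p ℕ.+ x , #north p ℕ.+ y)
foldl-move x y []          = refl
foldl-move x y (east ∷ p)  = trans (foldl-move (suc x) y p) (cong (_, #north p ℕ.+ y) (ℕ.+-suc (#east p) x))
foldl-move x y (north ∷ p) = trans (foldl-move x (suc y) p) (cong (#east p ℕ.+ x ,_) (ℕ.+-suc (#north p) y))

#east-++ : ∀ u v → #east (u ++ v) ≡ #east u ℕ.+ #east v
#east-++ []          v = refl
#east-++ (east ∷ u)  v = cong suc (#east-++ u v)
#east-++ (north ∷ u) v = #east-++ u v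

#north-++ : ∀ u v → #north (u ++ v) ≡ #north u ℕ.+ #north v
#north-++ []          v = refl
#north-++ (east ∷ u)  v = #north-++ u v
#north-++ (north ∷ u) v = cong suc (#north-++ u v)

length≡#east+#north : ∀ w → length w ≡ #east w ℕ.+ #north w
length≡#east+#north []          = refl
length≡#east+#north (east ∷ w)  = cong suc (length≡#east+#north w)
length≡#east+#north (north ∷ w) = trans (cong suc (length≡#east+#north w)) (sym (ℕ.+-suc (#east w) (#north w)))

words : ℕ → ℕ → List (List Step)
words zero    zero    = [] ∷ []
words (suc a) zero    = map (east ∷_) (words a zero)
words zero    (suc b) = map (north ∷_) (words zero b)
words (suc a) (suc b) = map (east ∷_) (words a (suc b)) ++ map (north ∷_) (words (suc a) b)

east-sound : ∀ {a b w} → IsWord a b w → IsWord (suc a) b (east ∷ w)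
east-sound (e , n) = cong suc e , n

north-sound : ∀ {a b w} → IsWord a b w → IsWord a (suc b) (north ∷ w)
north-sound (e , n) = e , cong suc n

words-sound : ∀ a b → All (IsWord a b) (words a b)
words-sound zero    zero    = (refl , refl) ∷ []
words-sound (suc a) zero    = Allₚ.map⁺ (All.map east-sound (words-sound a zero))
words-sound zero    (suc b) = Allₚ.map⁺ (All.map north-sound (words-sound zero b))
words-sound (suc a) (suc b) = Allₚ.++⁺ (Allₚ.map⁺ (All.map east-sound (words-sound a (suc b))))
                                       (Allₚ.map⁺ (All.map north-sound (words-sound (suc a) b)))

words-unique : ∀ a b → UniqueSetoid.Unique (≡.setoid (List Step)) (words a b)
words-unique zero    zero    = [] ∷ []
words-unique (suc a) zero    = Unique.map⁺ List.∷-injectiveʳ (words-unique a zero)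
words-unique zero    (suc b) = Unique.map⁺ List.∷-injectiveʳ (words-unique zero b)
words-unique (suc a) (suc b) = AllPairsₚ.++⁺
  (Unique.map⁺ List.∷-injectiveʳ (words-unique a (suc b)))
  (Unique.map⁺ List.∷-injectiveʳ (words-unique (suc a) b))
  (Allₚ.map⁺ (All.universal (λ _ → Allₚ.map⁺ (All.universal (λ _ ()) _)) _))

words-complete : ∀ {a b} w → IsWord a b w → w ∈ words a b
words-complete {zero}  {zero}  []          _ = here refl
words-complete {zero}  {zero}  (east ∷ w)  (() , _)
words-complete {zero}  {zero}  (north ∷ w) (_ , ())
words-complete {suc a} {zero}  (east ∷ w)  (e , n) = ∈-map⁺ (east ∷_) (words-complete w (ℕ.suc-injective e , n))
words-complete {zero}  {suc b} (north ∷ w) (e , n) = ∈-map⁺ (north ∷_) (words-complete w (e , ℕ.suc-injective n))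
words-complete {suc a} {suc b} (east ∷ w)  (e , n) = Anyₚ.++⁺ˡ (∈-map⁺ (east ∷_) (words-complete w (ℕ.suc-injective e , n)))
words-complete {suc a} {suc b} (north ∷ w) (e , n) = Anyₚ.++⁺ʳ _ (∈-map⁺ (north ∷_) (words-complete w (e , ℕ.suc-injective n)))

length-words : ∀ a b → length (words a b) ≡ (a ℕ.+ b) C a
length-words zero    zero    = refl
length-words (suc a) zero    = trans (List.length-map _ (words a zero)) (trans (length-words a zero)
  (trans (diagonal a) (sym (diagonal (suc a)))))
  where
  diagonal : ∀ a → (a ℕ.+ 0) C a ≡ 1
  diagonal a = trans (cong (_C a) (ℕ.+-identityʳ a)) (nCn≡1 a)
length-words zero    (suc b) = trans (List.length-map _ (words zero b)) (trans (length-words zero b)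
  (trans (nC0≡1 b) (sym (nC0≡1 (suc b)))))
length-words (suc a) (suc b) = trans (List.length-++ (map (east ∷_) (words a (suc b)))) (trans
  (cong₂ ℕ._+_ (trans (List.length-map _ (words a (suc b))) (length-words a (suc b)))
               (trans (List.length-map _ (words (suc a) b)) (trans (length-words (suc a) b)
                 (cong (_C suc a) (sym (ℕ.+-suc a b))))))
  (nCk+nC[k+1]≡[n+1]C[k+1] (a ℕ.+ suc b) a))

-- Rotations of words

rotate : List A → List A
rotate []       = []
rotate (x ∷ xs) = xs ∷ʳ x

rotate-injective : ∀ {xs ys : List A} → rotate xs ≡ rotate ys → xs ≡ ys
rotate-injective {xs = []}     {[]}     _  = refl
rotate-injective {xs = []}     {y ∷ ys} eq with () ← List.++-conicalʳ ys _ (sym eq)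
rotate-injective {xs = x ∷ xs} {[]}     eq with () ← List.++-conicalʳ xs _ eq
rotate-injective {xs = x ∷ xs} {y ∷ ys} eq with refl , refl ← List.∷ʳ-injective xs ys eq = refl

rotations : ℕ → List A → List A
rotations zero    xs = xs
rotations (suc i) xs = rotations i (rotate xs)

rotations-+ : ∀ i j (xs : List A) → rotations (i ℕ.+ j) xs ≡ rotations j (rotations i xs)
rotations-+ zero    j xs = refl
rotations-+ (suc i) j xs = rotations-+ i j (rotate xs)

rotations-++ : ∀ (u v : List A) → rotations (length u) (u ++ v) ≡ v ++ u
rotations-++ []      v = sym (List.++-identityʳ v)
rotations-++ (x ∷ u) v = trans (cong (rotations (length u)) (List.++-assoc u v _))
  (trans (rotations-++ u (v ∷ʳ x)) (List.++-assoc v _ u))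

rotate-sound : ∀ {a b w} → IsWord a b w → IsWord a b (rotate w)
rotate-sound {w = []} isW = isW
rotate-sound {w = s ∷ w} (e , n) =
  trans (#east-++ w _) (trans (ℕ.+-comm (#east w) _) (trans (sym (#east-++ (s ∷ []) w)) e)) ,
  trans (#north-++ w _) (trans (ℕ.+-comm (#north w) _) (trans (sym (#north-++ (s ∷ []) w)) n))

rotations-sound : ∀ i {a b w} → IsWord a b w → IsWord a b (rotations i w)
rotations-sound zero    isW = isW
rotations-sound (suc i) isW = rotations-sound i (rotate-sound isW)

-- The preimage moves the last step to the front; so rotation permutes the words with given numbers
-- of steps.
∈-words-rotate : ∀ {a b w} → IsWord a b w → w ∈ map rotate (words a b)
∈-words-rotate {w = w} (e , n) with initLast w
... | []      = ∈-map⁺ rotate (words-complete [] (e , n))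
... | w′ ∷ʳ′ s = ∈-map⁺ rotate (words-complete (s ∷ w′)
  ( trans (#east-++ (s ∷ []) w′) (trans (ℕ.+-comm _ (#east w′)) (trans (sym (#east-++ w′ (s ∷ []))) e))
  , trans (#north-++ (s ∷ []) w′) (trans (ℕ.+-comm _ (#north w′)) (trans (sym (#north-++ w′ (s ∷ []))) n)) ))

∑-words-rotate : ∀ a b F → ∑ (words a b) (F ∘ rotate) ≡ ∑ (words a b) F
∑-words-rotate a b F = trans (sym (∑-map rotate (words a b) F)) (∑-↭ (≡.setoid _) F (cong F)
  (unique⇒↭ (≡.setoid _) (Unique.map⁺ rotate-injective (words-unique a b)) (words-unique a b)
    (λ w∈ → words-complete _ (All.lookup (Allₚ.map⁺ (All.map rotate-sound (words-sound a b))) w∈))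
    (λ w∈ → ∈-words-rotate (All.lookup (words-sound a b) w∈))))

∑-words-rotations : ∀ a b F i → ∑ (words a b) (F ∘ rotations i) ≡ ∑ (words a b) F
∑-words-rotations a b F zero    = refl
∑-words-rotations a b F (suc i) = trans (∑-words-rotate a b (F ∘ rotations i)) (∑-words-rotations a b F i)

-- Levi's lemma: the end of z lies either within v or beyond it. It sorts the prefixes of a rotated
-- word.
++-split : ∀ (v u z z′ : List A) → v ++ u ≡ z ++ z′ →
           (∃[ c ] v ≡ z ++ c) ⊎ (∃[ c ] (z ≡ v ++ c × u ≡ c ++ z′))
++-split v       u []      z′ eq = inj₁ (v , refl)
++-split []      u (x ∷ z) z′ eq = inj₂ (x ∷ z , refl , eq)
++-split (y ∷ v) u (x ∷ z) z′ eq with refl , eq′ ← List.∷-injective eq with ++-split v u z z′ eq′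
... | inj₁ (c , refl)        = inj₁ (c , refl)
... | inj₂ (c , refl , eq″) = inj₂ (c , refl , eq″)

∑-𝟙-filter : ∀ {P : A → Set p} (P? : ∀ x → Dec (P x)) xs → ∑ xs (λ x → 𝟙 (P? x)) ≡ + length (filter P? xs)
∑-𝟙-filter P? []       = refl
∑-𝟙-filter P? (x ∷ xs) with P? x
... | yes _ = cong (λ z → 1ℤ ℤ.+ z) (∑-𝟙-filter P? xs)
... | no  _ = trans (ℤ.+-identityˡ _) (∑-𝟙-filter P? xs)

i≤i+j⇒0≤j : ∀ i j → i ℤ.≤ i ℤ.+ j → 0ℤ ℤ.≤ j
i≤i+j⇒0≤j i j i≤i+j = subst (0ℤ ℤ.≤_) (cancel i j) (ℤ.i≤j⇒0≤j-i i≤i+j)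
  where
  cancel : ∀ i j → i ℤ.+ j ℤ.- i ≡ j
  cancel = solve-∀

module CycleLemma (a b : ℕ) .{{_ : ℕ.NonZero a}} (coprime : gcd a b ≡ 1) where
  -- Turns the diagonal into a level: the value is nonnegative exactly on and above it, and each
  -- step changes it by a constant, so that factors of a word have heights that add up.
  pointHeight : Point → ℤ
  pointHeight (x , y) = + a ℤ.* + y ℤ.- + b ℤ.* + x

  stepHeight : Step → ℤ
  stepHeight east  = ℤ.- (+ b)
  stepHeight north = + a

  height : List Step → ℤ
  height []      = 0ℤ
  height (s ∷ p) = stepHeight s ℤ.+ height p

  height-++ : ∀ u v → height (u ++ v) ≡ height u ℤ.+ height v
  height-++ []      v = sym (ℤ.+-identityˡ _)
  height-++ (s ∷ u) v = trans (cong (λ z → stepHeight s ℤ.+ z) (height-++ u v)) (sym (ℤ.+-assoc (stepHeight s) _ _))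

  pointHeight-move : ∀ q s → pointHeight (move q s) ≡ pointHeight q ℤ.+ stepHeight s
  pointHeight-move (x , y) east  = east-move (+ a) (+ b) (+ x) (+ y)
    where
    east-move : ∀ a b x y → a ℤ.* y ℤ.- b ℤ.* (1ℤ ℤ.+ x) ≡ (a ℤ.* y ℤ.- b ℤ.* x) ℤ.+ ℤ.- b
    east-move = solve-∀
  pointHeight-move (x , y) north = north-move (+ a) (+ b) (+ x) (+ y)
    where
    north-move : ∀ a b x y → a ℤ.* (1ℤ ℤ.+ y) ℤ.- b ℤ.* x ≡ (a ℤ.* y ℤ.- b ℤ.* x) ℤ.+ a
    north-move = solve-∀

  height-counts : ∀ p → height p ≡ + a ℤ.* + #north p ℤ.- + b ℤ.* + #east p
  height-counts []          = sym (cong₂ ℤ._-_ (ℤ.*-zeroʳ (+ a)) (ℤ.*-zeroʳ (+ b)))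
  height-counts (east ∷ p)  = trans (cong (λ z → ℤ.- (+ b) ℤ.+ z) (height-counts p))
    (rearrange (+ a) (+ b) (+ #east p) (+ #north p))
    where
    rearrange : ∀ a b e n → ℤ.- b ℤ.+ (a ℤ.* n ℤ.- b ℤ.* e) ≡ a ℤ.* n ℤ.- b ℤ.* (1ℤ ℤ.+ e)
    rearrange = solve-∀
  height-counts (north ∷ p) = trans (cong (λ z → + a ℤ.+ z) (height-counts p))
    (rearrange (+ a) (+ b) (+ #east p) (+ #north p))
    where
    rearrange : ∀ a b e n → a ℤ.+ (a ℤ.* n ℤ.- b ℤ.* e) ≡ a ℤ.* (1ℤ ℤ.+ n) ℤ.- b ℤ.* e
    rearrange = solve-∀

  above⇒nonNegative : ∀ q → Above a b q → 0ℤ ℤ.≤ pointHeight q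
  above⇒nonNegative (x , y) bx≤ay = ℤ.i≤j⇒0≤j-i (subst₂ ℤ._≤_ (ℤ.pos-* b x) (ℤ.pos-* a y) (ℤ.+≤+ bx≤ay))

  nonNegative⇒above : ∀ q → 0ℤ ℤ.≤ pointHeight q → Above a b q
  nonNegative⇒above (x , y) 0≤h = ℤ.drop‿+≤+ (subst₂ ℤ._≤_ (sym (ℤ.pos-* b x)) (sym (ℤ.pos-* a y)) (ℤ.0≤i-j⇒j≤i 0≤h))

  -- h is the height of the starting point. Factorisations replace vertices because a rotation
  -- exchanges the two factors of a concatenation.
  PrefixesAbove : ℤ → List Step → Set
  PrefixesAbove h p = ∀ u v → p ≡ u ++ v → 0ℤ ℤ.≤ h ℤ.+ height u

  vertices⇒prefixes : ∀ q p → All (Above a b) (vertices q p) → PrefixesAbove (pointHeight q) p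
  vertices⇒prefixes q []      (above ∷ _) [] _ _ = subst (0ℤ ℤ.≤_) (sym (ℤ.+-identityʳ _)) (above⇒nonNegative q above)
  vertices⇒prefixes q (s ∷ p) (above ∷ _) [] _ _ = subst (0ℤ ℤ.≤_) (sym (ℤ.+-identityʳ _)) (above⇒nonNegative q above)
  vertices⇒prefixes q (s ∷ p) (_ ∷ aboves) (s ∷ u) v refl = subst (0ℤ ℤ.≤_)
    (trans (cong (λ z → z ℤ.+ height u) (pointHeight-move q s)) (ℤ.+-assoc (pointHeight q) _ _))
    (vertices⇒prefixes (move q s) p aboves u v refl)

  prefixes⇒vertices : ∀ q p → PrefixesAbove (pointHeight q) p → All (Above a b) (vertices q p)
  prefixes⇒vertices q p aboves with nonNegative⇒above q (subst (0ℤ ℤ.≤_) (ℤ.+-identityʳ _) (aboves [] p refl))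
  prefixes⇒vertices q []      aboves | above = above ∷ []
  prefixes⇒vertices q (s ∷ p) aboves | above = above ∷ prefixes⇒vertices (move q s) p λ u v p≡ →
    subst (0ℤ ℤ.≤_) (trans (sym (ℤ.+-assoc (pointHeight q) _ _)) (cong (λ z → z ℤ.+ height u) (sym (pointHeight-move q s))))
      (aboves (s ∷ u) v (cong (s ∷_) p≡))

  Stays : List Step → Set
  Stays p = All (Above a b) (vertices (0 , 0) p)

  stays? : ∀ p → Dec (Stays p)
  stays? p = All.all? (λ (x , y) → b ℕ.* x ℕ.≤? a ℕ.* y) (vertices (0 , 0) p)

  pointHeight-origin : ∀ z → pointHeight (0 , 0) ℤ.+ z ≡ z
  pointHeight-origin z = trans (cong (λ h → h ℤ.+ z) (cong₂ ℤ._-_ (ℤ.*-zeroʳ (+ a)) (ℤ.*-zeroʳ (+ b)))) (ℤ.+-identityˡ z)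

  stays⇒prefix≥0 : ∀ u v → Stays (u ++ v) → 0ℤ ℤ.≤ height u
  stays⇒prefix≥0 u v stays = subst (0ℤ ℤ.≤_) (pointHeight-origin _) (vertices⇒prefixes (0 , 0) (u ++ v) stays u v refl)

  prefixes≥0⇒stays : ∀ p → (∀ u v → p ≡ u ++ v → 0ℤ ℤ.≤ height u) → Stays p
  prefixes≥0⇒stays p pos = prefixes⇒vertices (0 , 0) p λ u v p≡ → subst (0ℤ ℤ.≤_) (sym (pointHeight-origin _)) (pos u v p≡)

  height-word : ∀ {w} → IsWord a b w → height w ≡ 0ℤ
  height-word {w} (e , n) = trans (height-counts w) (trans
    (cong₂ (λ n e → + a ℤ.* + n ℤ.- + b ℤ.* + e) n e) (vanish (+ a) (+ b)))
    where
    vanish : ∀ a b → a ℤ.* b ℤ.- b ℤ.* a ≡ 0ℤ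
    vanish = solve-∀

  minimalPrefix : ∀ w → ∃[ u ] ∃[ v ] (w ≡ u ++ v × (∀ u′ v′ → w ≡ u′ ++ v′ → height u ℤ.≤ height u′))
  minimalPrefix []      = [] , [] , refl , λ { [] _ _ → ℤ.≤-refl }
  minimalPrefix (s ∷ w) with u , v , w≡ , minimal ← minimalPrefix w with ℤ.≤-total (stepHeight s ℤ.+ height u) 0ℤ
  ... | inj₁ ≤0 = s ∷ u , v , cong (s ∷_) w≡ , λ
    { []       v′ _  → ≤0
    ; (_ ∷ u′) v′ eq → case List.∷-injective eq of λ { (refl , eq′) → ℤ.+-monoʳ-≤ (stepHeight s) (minimal u′ v′ eq′) } }
  ... | inj₂ 0≤ = [] , s ∷ w , refl , λ
    { []       v′ _  → ℤ.≤-refl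
    ; (_ ∷ u′) v′ eq → case List.∷-injective eq of λ { (refl , eq′) →
        ℤ.≤-trans 0≤ (ℤ.+-monoʳ-≤ (stepHeight s) (minimal u′ v′ eq′)) } }

  -- The rotated path starts at a lowest vertex. Its prefixes within v lead to vertices of the
  -- original path; beyond v it meets the vertices of u again, since the total height is 0. None of
  -- these is lower than the start.
  stays-from-minimal : ∀ u v → height (u ++ v) ≡ 0ℤ →
                       (∀ u′ v′ → u ++ v ≡ u′ ++ v′ → height u ℤ.≤ height u′) → Stays (v ++ u)
  stays-from-minimal u v closed minimal = prefixes≥0⇒stays (v ++ u) λ z z′ eq →
    [ within-v z , beyond-v z z′ ]′ (++-split v u z z′ eq)
    where
    within-v : ∀ z → (∃[ c ] v ≡ z ++ c) → 0ℤ ℤ.≤ height z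
    within-v z (c , refl) = i≤i+j⇒0≤j (height u) (height z) (subst (height u ℤ.≤_) (height-++ u z)
      (minimal (u ++ z) c (sym (List.++-assoc u z c))))

    beyond-v : ∀ z z′ → (∃[ c ] (z ≡ v ++ c × u ≡ c ++ z′)) → 0ℤ ℤ.≤ height z
    beyond-v z z′ (c , refl , u≡) = i≤i+j⇒0≤j (height u) (height z) (subst (height u ℤ.≤_) eq
      (minimal c (z′ ++ v) (trans (cong (_++ v) u≡) (List.++-assoc c z′ v))))
      where
      eq : height c ≡ height u ℤ.+ height (v ++ c)
      eq = begin
        height c                                ≡⟨ ℤ.+-identityˡ _ ⟨
        0ℤ ℤ.+ height c                         ≡⟨ cong (λ h → h ℤ.+ height c) (trans (sym closed) (height-++ u v)) ⟩
        height u ℤ.+ height v ℤ.+ height c      ≡⟨ ℤ.+-assoc (height u) _ _ ⟩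
        height u ℤ.+ (height v ℤ.+ height c)    ≡⟨ cong (λ h → height u ℤ.+ h) (height-++ v c) ⟨
        height u ℤ.+ height (v ++ c)            ∎
        where open ≡.≡-Reasoning

  rotation-stays : ∀ {w} → IsWord a b w → ∃[ i ] (i < a ℕ.+ b × Stays (rotations i w))
  rotation-stays {w} isW with minimalPrefix w
  -- Here u is the whole word and its length a + b is out of range; as its height is 0, the empty
  -- prefix is minimal too, and index 0 serves.
  ... | u , [] , w≡ , minimal = 0 , ℕ.≤-trans (ℕ.>-nonZero⁻¹ a) (ℕ.m≤m+n a b) ,
    subst Stays (List.++-identityʳ w) (stays-from-minimal [] w closed λ u′ v′ eq →
      ℤ.≤-trans (ℤ.≤-reflexive (trans (sym closed) (cong height (trans w≡ (List.++-identityʳ u))))) (minimal u′ v′ eq))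
    where closed = height-word isW
  ... | u , s ∷ v , refl , minimal = length u , u<a+b ,
    subst Stays (sym (rotations-++ u (s ∷ v))) (stays-from-minimal u (s ∷ v) (height-word isW) minimal)
    where
    u<a+b : length u < a ℕ.+ b
    u<a+b = subst (length u <_) (trans (sym (List.length-++ u)) (trans (length≡#east+#north (u ++ s ∷ v))
      (cong₂ ℕ._+_ (easts isW) (norths isW)))) (ℕ.m<m+n (length u) ℕ.z<s)

  counts≡0⇒[] : ∀ w → #east w ≡ 0 → #north w ≡ 0 → w ≡ []
  counts≡0⇒[] []          _ _  = refl
  counts≡0⇒[] (east ∷ w)  () _
  counts≡0⇒[] (north ∷ w) _ ()

  -- This is where coprimality enters: a · #north u = b · #east u gives a ∣ #east u, and #east u ≤ a
  -- leaves only 0 and a.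
  height≡0⇒trivial : ∀ u v → IsWord a b (u ++ v) → height u ≡ 0ℤ → u ≡ [] ⊎ v ≡ []
  height≡0⇒trivial u v isW h≡0 = go (#east u) refl
    where
    balance : a ℕ.* #north u ≡ b ℕ.* #east u
    balance = ℤ.+-injective (trans (ℤ.pos-* a (#north u)) (trans
      (ℤ.i-j≡0⇒i≡j _ _ (trans (sym (height-counts u)) h≡0)) (sym (ℤ.pos-* b (#east u)))))

    a∣#east : a ∣ #east u
    a∣#east = coprime-divisor (gcd≡1⇒coprime coprime) (divides (#north u) (trans (sym balance) (ℕ.*-comm a (#north u))))

    split-east : #east u ℕ.+ #east v ≡ a
    split-east = trans (sym (#east-++ u v)) (easts isW)

    split-north : #north u ℕ.+ #north v ≡ b
    split-north = trans (sym (#north-++ u v)) (norths isW)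

    go : ∀ e → #east u ≡ e → u ≡ [] ⊎ v ≡ []
    go zero    e≡ = inj₁ (counts≡0⇒[] u e≡ (ℕ.*-cancelˡ-≡ _ 0 a (trans balance
      (trans (cong (b ℕ.*_) e≡) (trans (ℕ.*-zeroʳ b) (sym (ℕ.*-zeroʳ a)))))))
    go (suc e) e≡ = inj₂ (counts≡0⇒[] v
      (ℕ.+-cancelˡ-≡ (#east u) _ 0 (trans split-east (trans (sym #east≡a) (sym (ℕ.+-identityʳ _)))))
      (ℕ.+-cancelˡ-≡ (#north u) _ 0 (trans split-north (trans (sym #north≡b) (sym (ℕ.+-identityʳ _))))))
      where
      #east≡a : #east u ≡ a
      #east≡a = ℕ.≤-antisym (subst (#east u ℕ.≤_) split-east (ℕ.m≤m+n _ _))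
        (subst (a ℕ.≤_) (sym e≡) (∣⇒≤ (subst (a ∣_) e≡ a∣#east)))

      #north≡b : #north u ≡ b
      #north≡b = ℕ.*-cancelˡ-≡ _ _ a (trans balance (trans (cong (b ℕ.*_) #east≡a) (ℕ.*-comm b a)))

  -- If both rotations stay above, u and v have nonnegative heights with sum 0, so
  -- `height≡0⇒trivial` applies.
  stays-unique : ∀ u v → IsWord a b (u ++ v) → Stays (u ++ v) → Stays (v ++ u) → u ≡ [] ⊎ v ≡ []
  stays-unique u v isW stays stays′ = height≡0⇒trivial u v isW (ℤ.≤-antisym
    (subst₂ ℤ._≤_ (ℤ.+-identityʳ (height u)) (trans (sym (height-++ u v)) (height-word isW))
      (ℤ.+-monoʳ-≤ (height u) (stays⇒prefix≥0 v u stays′)))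
    (stays⇒prefix≥0 u v stays))

  length-word : ∀ {w} → IsWord a b w → length w ≡ a ℕ.+ b
  length-word {w} isW = trans (length≡#east+#north w) (cong₂ ℕ._+_ (easts isW) (norths isW))

  proper-rotation-falls : ∀ {w} → IsWord a b w → Stays w → ∀ i → 0 < i → i < a ℕ.+ b → ¬ Stays (rotations i w)
  proper-rotation-falls {w} isW stays i 0<i i<a+b stays′ =
    [ (λ u≡[] → ℕ.<⇒≢ 0<i (sym (trans (sym |u|≡i) (cong length u≡[]))))
    , (λ v≡[] → ℕ.<⇒≢ i<a+b (trans (sym |u|≡i) (trans (sym (cong length (trans (cong (u ++_) v≡[]) (List.++-identityʳ u))))
        (trans (cong length w≡) (length-word isW)))))
    ]′ (stays-unique u v (subst (IsWord a b) (sym w≡) isW) (subst Stays (sym w≡) stays)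
      (subst Stays (trans (cong₂ rotations (sym |u|≡i) (sym w≡)) (rotations-++ u v)) stays′))
    where
    u v : List Step
    u = take i w
    v = drop i w
    w≡ : u ++ v ≡ w
    w≡ = List.take++drop≡id i w
    |u|≡i : length u ≡ i
    |u|≡i = trans (List.length-take i w) (ℕ.m≤n⇒m⊓n≡m (ℕ.<⇒≤ (subst (i <_) (sym (length-word isW)) i<a+b)))

  staying-rotations-ordered : ∀ {w} → IsWord a b w → ∀ {i j} → i < j → j < a ℕ.+ b →
                              Stays (rotations i w) → ¬ Stays (rotations j w)
  staying-rotations-ordered {w} isW {i} {j} i<j j<a+b stays stays′ =
    proper-rotation-falls (rotations-sound i isW) stays (j ∸ i) (ℕ.m<n⇒0<n∸m i<j) (ℕ.≤-<-trans (ℕ.m∸n≤m j i) j<a+b)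
      (subst Stays (trans (cong (λ k → rotations k w) (sym (ℕ.m+[n∸m]≡n (ℕ.<⇒≤ i<j)))) (rotations-+ i (j ∸ i) w)) stays′)

  one-rotation-stays : ∀ {w} → IsWord a b w → ∑ (downFrom (a ℕ.+ b)) (λ i → 𝟙 (stays? (rotations i w))) ≡ 1ℤ
  one-rotation-stays {w} isW with i , i<a+b , stays ← rotation-stays isW =
    ∑-downFrom-𝟙-unique (λ i → stays? (rotations i w)) (a ℕ.+ b) i<a+b stays unique
    where
    unique : ∀ {j} → j < a ℕ.+ b → Stays (rotations j w) → j ≡ i
    unique {j} j<a+b stays′ with ℕ.<-cmp j i
    ... | tri< j<i _ _ = contradiction stays (staying-rotations-ordered isW j<i i<a+b stays′)
    ... | tri≈ _ j≡i _ = j≡i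
    ... | tri> _ _ i<j = contradiction stays′ (staying-rotations-ordered isW i<j j<a+b stays)

  dyckPaths : List (List Step)
  dyckPaths = filter stays? (words a b)

  Dyck-cardinality : HasCardinality (Dyck a b) (length dyckPaths)
  Dyck-cardinality = enumeration⇒cardinality (≡.setoid _) (IsDyck a b)
    (Unique.filter⁺ stays? (words-unique a b))
    (All.tabulate λ {p} p∈ → let p∈words , stays = ∈-filter⁻ stays? p∈ in
      trans (foldl-move 0 0 p) (endpoint p (All.lookup (words-sound a b) p∈words)) , stays)
    λ {p} (end , stays) → ∈-filter⁺ stays? (words-complete p (isWord p end)) stays
    where
    endpoint : ∀ p → IsWord a b p → (#east p ℕ.+ 0 , #north p ℕ.+ 0) ≡ (a , b)
    endpoint p (e , n) = cong₂ _,_ (trans (ℕ.+-identityʳ _) e) (trans (ℕ.+-identityʳ _) n)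
    isWord : ∀ p → foldl move (0 , 0) p ≡ (a , b) → IsWord a b p
    isWord p end with eq ← trans (sym (foldl-move 0 0 p)) end =
      trans (sym (ℕ.+-identityʳ _)) (cong proj₁ eq) , trans (sym (ℕ.+-identityʳ _)) (cong proj₂ eq)

  -- Double counting of the pairs (i, w) for which the i-th rotation of w stays above: each i
  -- contributes the number of Dyck paths, because rotation permutes the words, and each word
  -- contributes 1.
  [a+b]*#dyckPaths : (a ℕ.+ b) ℕ.* length dyckPaths ≡ (a ℕ.+ b) C a
  [a+b]*#dyckPaths = ℤ.+-injective (begin
    + ((a ℕ.+ b) ℕ.* length dyckPaths)
      ≡⟨ ℤ.pos-* (a ℕ.+ b) _ ⟩
    + (a ℕ.+ b) ℤ.* + length dyckPaths
      ≡⟨ cong₂ (λ n z → + n ℤ.* z) (sym (List.length-downFrom (a ℕ.+ b))) (sym (∑-𝟙-filter stays? (words a b))) ⟩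
    + length (downFrom (a ℕ.+ b)) ℤ.* ∑ (words a b) stays
      ≡⟨ ∑-const (downFrom (a ℕ.+ b)) (∑ (words a b) stays) ⟨
    ∑ (downFrom (a ℕ.+ b)) (λ _ → ∑ (words a b) stays)
      ≡⟨ ∑-cong (downFrom (a ℕ.+ b)) (λ i → sym (∑-words-rotations a b stays i)) ⟩
    ∑ (downFrom (a ℕ.+ b)) (λ i → ∑ (words a b) (λ w → stays (rotations i w)))
      ≡⟨ ∑-swap (downFrom (a ℕ.+ b)) (words a b) _ ⟩
    ∑ (words a b) (λ w → ∑ (downFrom (a ℕ.+ b)) (λ i → stays (rotations i w)))
      ≡⟨ ∑-cong-∈ (words a b) (λ w∈ → one-rotation-stays (All.lookup (words-sound a b) w∈)) ⟩
    ∑ (words a b) (λ _ → 1ℤ)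
      ≡⟨ trans (∑-const (words a b) 1ℤ) (ℤ.*-identityʳ _) ⟩
    + length (words a b)
      ≡⟨ cong +_ (length-words a b) ⟩
    + ((a ℕ.+ b) C a) ∎)
    where
    open ≡.≡-Reasoning
    stays : List Step → ℤ
    stays w = 𝟙 (stays? w)

-- Zero-sum multisets and subsets

filter-∈-suc : ∀ {n} b (S : Subset n) is → filter (_∈? (b ∷ S)) (map suc is) ≡ map suc (filter (_∈? S) is)
filter-∈-suc b S []       = refl
filter-∈-suc b S (i ∷ is) with does (i ∈? S)
... | true  = cong (suc i ∷_) (filter-∈-suc b S is)
... | false = filter-∈-suc b S is

module Counting (G : FiniteAbelianGroup a ℓ) where
  open FiniteAbelianGroup G hiding (order) renaming (refl to ≈-refl; sym to ≈-sym; trans to ≈-trans; reflexive to ≈-reflexive)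
  open Algebra.Properties.Group group using (x≈z//y; //-rightDividesˡ; ∙-cancelʳ; identityʳ-unique; ε⁻¹≈ε)
  open Algebra.Properties.AbelianGroup abelianGroup using (⁻¹-∙-comm)
  open Algebra.Properties.CommutativeSemigroup commutativeSemigroup using (interchange)
  open Algebra.Properties.Monoid.Mult monoid using (×-assocˡ; ×-congˡ) renaming (_×_ to _·_)
  open SetoidMembership setoid using () renaming (_∈_ to _∈′_)
  open UniqueSetoid setoid using (Unique)
  open Permutation setoid using (_↭_; prep; swap; ↭-refl; ↭-sym; ↭-trans; ↭-setoid)
    renaming (refl to ≋⇒↭; trans to _⨾_)

  -- The elements of G and their translates

  index : Carrier → Fin (order G)
  index x = proj₁ (Bijection.surjective finite x)

  element-index : ∀ x → element (index x) ≈ x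
  element-index x = proj₂ (Bijection.surjective finite x) refl

  infix 4 _≈?_
  -- The enumeration makes the abstract equality of G decidable: indices are compared instead.
  _≈?_ : ∀ x y → Dec (x ≈ y)
  x ≈? y = map′ (λ eq → ≈-trans (≈-sym (element-index x)) (≈-trans (≈-reflexive (cong element eq)) (element-index y)))
                (λ x≈y → Bijection.injective finite (≈-trans (element-index x) (≈-trans x≈y (≈-sym (element-index y)))))
                (index x Fin.≟ index y)

  universe : List Carrier
  universe = map element (allFin (order G))

  length-universe : length universe ≡ order G
  length-universe = trans (List.length-map element (allFin (order G))) (List.length-tabulate {n = order G} id)

  universe-unique : Unique universe
  universe-unique = UniqueSetoidₚ.map⁺ (≡.setoid _) setoid (Bijection.injective finite) (Unique.allFin⁺ (order G))

  ∈-universe : ∀ x → x ∈′ universe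
  ∈-universe x = SetoidMembershipₚ.∈-resp-≈ setoid (element-index x)
    (SetoidMembershipₚ.∈-map⁺ (≡.setoid _) setoid (≈-reflexive ∘ cong element) (∈-allFin (index x)))

  ∙⇒minus : ∀ {x y s} → x ∙ y ≈ s → y ≈ s - x
  ∙⇒minus {x} {y} {s} eq = x≈z//y y x s (≈-trans (comm y x) eq)

  minus⇒∙ : ∀ {x y s} → y ≈ s - x → x ∙ y ≈ s
  minus⇒∙ {x} {y} {s} eq = ≈-trans (∙-congˡ eq) (≈-trans (comm x (s - x)) (//-rightDividesˡ x s))

  minus-comm : ∀ s x y → s - x - y ≈ s - y - x
  minus-comm s x y = ≈-trans (assoc s _ _) (≈-trans (∙-congˡ (comm _ _)) (≈-sym (assoc s _ _)))

  universe-translate : ∀ t → map (_∙ t) universe ↭ universe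
  universe-translate t = unique⇒↭ setoid
    (UniqueSetoidₚ.map⁺ setoid setoid (λ {x} {y} → ∙-cancelʳ t x y) universe-unique) universe-unique
    (λ {z} _ → ∈-universe z)
    (λ {z} _ → SetoidMembershipₚ.∈-resp-≈ setoid (//-rightDividesˡ t z)
      (SetoidMembershipₚ.∈-map⁺ setoid setoid ∙-congʳ (∈-universe (z - t))))

  -- Each multiset is represented once, by the list of its terms in the order of xs. The prescribed
  -- sum is reduced along the way, so that the count by sums inherits a recursion.
  multisets : List Carrier → ℕ → Carrier → List (List Carrier)
  multisets []       zero    s with ε ≈? s
  ... | yes _ = [] ∷ []
  ... | no  _ = []
  multisets []       (suc m) s = []
  multisets (x ∷ xs) zero    s = multisets xs zero s
  multisets (x ∷ xs) (suc m) s = multisets xs (suc m) s ++ map (x ∷_) (multisets (x ∷ xs) m (s - x))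

  IsMultiset : List Carrier → ℕ → Carrier → List Carrier → Set _
  IsMultiset xs m s S = All (_∈′ xs) S × length S ≡ m × σ G S ≈ s

  multisets-sound : ∀ xs m s → All (IsMultiset xs m s) (multisets xs m s)
  multisets-sound []       zero    s with ε ≈? s
  ... | yes ε≈s = ([] , refl , ε≈s) ∷ []
  ... | no  _   = []
  multisets-sound []       (suc m) s = []
  multisets-sound (x ∷ xs) zero    s = All.map (λ (S⊆ , rest) → All.map there S⊆ , rest) (multisets-sound xs zero s)
  multisets-sound (x ∷ xs) (suc m) s = Allₚ.++⁺
    (All.map (λ (S⊆ , rest) → All.map there S⊆ , rest) (multisets-sound xs (suc m) s))
    (Allₚ.map⁺ (All.map (λ (S⊆ , len , sum) → here ≈-refl ∷ S⊆ , cong suc len , minus⇒∙ sum)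
                        (multisets-sound (x ∷ xs) m (s - x))))

  multisets-unique : ∀ {xs} m s → Unique xs → UniqueSetoid.Unique ↭-setoid (multisets xs m s)
  multisets-unique {[]}     zero    s u with ε ≈? s
  ... | yes _ = [] ∷ []
  ... | no  _ = []
  multisets-unique {[]}     (suc m) s u = []
  multisets-unique {x ∷ xs} zero    s (_ ∷ u) = multisets-unique zero s u
  multisets-unique {x ∷ xs} (suc m) s (x∉xs ∷ u) = AllPairsₚ.++⁺
    (multisets-unique (suc m) s u)
    (AllPairsₚ.map⁺ (AllPairs.map (_∘ Permutationₚ.drop-∷ setoid) (multisets-unique m (s - x) (x∉xs ∷ u))))
    (All.map (λ (S⊆ , _) → Allₚ.map⁺ (All.universal (λ T r →
        SetoidMembershipₚ.All[≉]⇒∉ setoid x∉xs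
          (All.lookupₛ setoid (λ z≈z′ → SetoidMembershipₚ.∈-resp-≈ setoid z≈z′) S⊆
            (Permutationₚ.∈-resp-↭ setoid (↭-sym r) (here ≈-refl)))) _))
      (multisets-sound xs (suc m) s))

  σ-↭ : ∀ {S T} → S ↭ T → σ G S ≈ σ G T
  σ-↭ = Permutationₚ.foldr-commMonoid setoid isCommutativeMonoid

  remove : ∀ {x xs m s S} → x ∈′ S → IsMultiset xs (suc m) s S →
           Σ[ T ∈ List Carrier ] (S ↭ x ∷ T × IsMultiset xs m (s - x) T)
  remove x∈S (S⊆ , len , sum) with T , r ← ∈⇒↭∷ setoid x∈S
                              with _ ∷ T⊆ ← Permutationₚ.All-resp-↭ setoid (SetoidMembershipₚ.∈-resp-≈ setoid) r S⊆ =
    T , r , T⊆ , ℕ.suc-injective (trans (sym (Permutationₚ.xs↭ys⇒|xs|≡|ys| setoid r)) len)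
          , ∙⇒minus (≈-trans (≈-sym (σ-↭ r)) sum)

  ∉⇒⊆tail : ∀ {x xs S} → All (_∈′ (x ∷ xs)) S → ¬ (x ∈′ S) → All (_∈′ xs) S
  ∉⇒⊆tail []                x∉S = []
  ∉⇒⊆tail (here y≈x ∷ S⊆)   x∉S = ⊥-elim (x∉S (here (≈-sym y≈x)))
  ∉⇒⊆tail (there y∈xs ∷ S⊆) x∉S = y∈xs ∷ ∉⇒⊆tail S⊆ (x∉S ∘ there)

  MultisetsComplete : List Carrier → ℕ → Carrier → Set _
  MultisetsComplete xs m s = ∀ {S} → IsMultiset xs m s S → SetoidMembership._∈_ ↭-setoid S (multisets xs m s)

  multisets-complete-∷ : ∀ {x xs m s} → MultisetsComplete xs (suc m) s → MultisetsComplete (x ∷ xs) m (s - x) →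
                         MultisetsComplete (x ∷ xs) (suc m) s
  multisets-complete-∷ {x} without with′ {S} isS with Any.any? (x ≈?_) S
  ... | yes x∈S = let T , r , isT = remove x∈S isS in
    Anyₚ.++⁺ʳ _ (Anyₚ.map⁺ (Any.map (λ T↭ → ↭-trans r (prep ≈-refl T↭)) (with′ isT)))
  ... | no  x∉S = Anyₚ.++⁺ˡ (without (∉⇒⊆tail (proj₁ isS) x∉S , proj₂ isS))

  multisets-complete : ∀ xs m s → MultisetsComplete xs m s
  multisets-complete []       zero    s {[]} (_ , _ , ε≈s) with ε ≈? s
  ... | yes _   = here ↭-refl
  ... | no  ε≉s = contradiction ε≈s ε≉s
  multisets-complete []       (suc m) s (() ∷ _ , _)
  multisets-complete (x ∷ xs) zero    s {[]} (_ , rest) = multisets-complete xs zero s ([] , rest)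
  multisets-complete (x ∷ xs) (suc m) s =
    multisets-complete-∷ (multisets-complete xs (suc m) s) (multisets-complete (x ∷ xs) m (s - x))

  #multisets : List Carrier → ℕ → Carrier → ℤ
  #multisets xs m s = + length (multisets xs m s)

  M-cardinality : ∀ m → HasCardinality (M G m) (length (multisets universe m ε))
  M-cardinality m = enumeration⇒cardinality ↭-setoid _ (multisets-unique m ε universe-unique)
    (All.map proj₂ (multisets-sound universe m ε))
    (λ {S} isM → multisets-complete universe m ε (All.universal ∈-universe S , isM))

  #multisets-∷ : ∀ x xs m s → #multisets (x ∷ xs) (suc m) s ≡ #multisets xs (suc m) s ℤ.+ #multisets (x ∷ xs) m (s - x)
  #multisets-∷ x xs m s = trans
    (cong +_ (trans (List.length-++ (multisets xs (suc m) s))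
      (cong (length (multisets xs (suc m) s) ℕ.+_) (List.length-map _ (multisets (x ∷ xs) m (s - x))))))
    (ℤ.pos-+ (length (multisets xs (suc m) s)) _)

  #multisets-[] : ∀ s → #multisets [] 0 s ≡ 𝟙 (ε ≈? s)
  #multisets-[] s with ε ≈? s
  ... | yes _ = refl
  ... | no  _ = refl

  ∑-universe-translate : ∀ F → (∀ {s s′} → s ≈ s′ → F s ≡ F s′) → ∀ x →
                         ∑ universe (λ s → F (s - x)) ≡ ∑ universe F
  ∑-universe-translate F F-cong x = trans (sym (∑-map (_- x) universe F))
    (∑-↭ setoid F F-cong (universe-translate (x ⁻¹)))

  ∑-universe-𝟙 : ∀ x → ∑ universe (λ y → 𝟙 (x ≈? y)) ≡ 1ℤ
  ∑-universe-𝟙 x = ∑-𝟙-unique setoid (x ≈?_) (λ y≈z x≈y → ≈-trans x≈y y≈z) universe-unique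
    (∈-universe x) ≈-refl (λ _ → ≈-sym)

  σ-translate : ∀ t xs → σ G (map (_∙ t) xs) ≈ σ G xs ∙ (length xs · t)
  σ-translate t []       = ≈-sym (identityˡ ε)
  σ-translate t (x ∷ xs) = ≈-trans (∙-congˡ (σ-translate t xs)) (interchange x t (σ G xs) (length xs · t))

  -- Translation by t permutes G, so the sum of all elements is unchanged; on the other hand it
  -- grows by |G| · t.
  order-· : ∀ t → order G · t ≈ ε
  order-· t = subst (λ n → n · t ≈ ε) length-universe
    (identityʳ-unique (σ G universe) _ (≈-trans (≈-sym (σ-translate t universe)) (σ-↭ (universe-translate t))))

  order-*-· : ∀ k t → (k ℕ.* order G) · t ≈ ε
  order-*-· k t = ≈-trans (×-congˡ {t} (ℕ.*-comm k (order G)))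
    (≈-trans (≈-sym (×-assocˡ t (order G) k)) (order-· (k · t)))

  -- As m is prime to |G|, every element is of the form m · t.
  ∑-uniform : ∀ {m} F → (∀ {s s′} → s ≈ s′ → F s ≡ F s′) → (∀ t s → F (s ∙ (m · t)) ≡ F s) →
              gcd m (order G) ≡ 1 → ∑ universe F ≡ + order G ℤ.* F ε
  ∑-uniform {m} F F-cong F-translate coprime = trans (∑-cong universe F-constant)
    (trans (∑-const universe (F ε)) (cong (λ n → + n ℤ.* F ε) length-universe))
    where
    m·x·s : ∀ x s → m · (x · s) ≈ (x ℕ.* m) · s
    m·x·s x s = ≈-trans (×-assocˡ s m x) (×-congˡ {s} (ℕ.*-comm m x))

    F-constant : ∀ s → F s ≡ F ε
    F-constant s with Bézout.identity (subst (λ d → GCD.GCD m (order G) d) coprime (gcd-GCD m (order G)))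
    -- Here 1 + y|G| = xm, so s = m · (x · s) is reached from ε. In the other case 1 + xm = y|G|,
    -- and adding m · (x · s) leads from s to ε.
    ... | Bézout.+- x y eq = trans (F-cong
      (≈-sym (≈-trans (identityˡ _) (≈-trans (m·x·s x s) (≈-trans (×-congˡ {s} (sym eq))
        (≈-trans (∙-congˡ (order-*-· y s)) (identityʳ s))))))) (F-translate (x · s) ε)
    ... | Bézout.-+ x y eq = trans (sym (F-translate (x · s) s)) (F-cong
      (≈-trans (∙-congˡ (m·x·s x s)) (≈-trans (×-congˡ {s} eq) (order-*-· y s))))

  #multisets-cong : ∀ xs m {s s′} → s ≈ s′ → #multisets xs m s ≡ #multisets xs m s′
  #multisets-cong []       zero    {s} {s′} s≈s′ = trans (#multisets-[] s)
    (trans (𝟙-cong (ε ≈? s) (ε ≈? s′) (λ e → ≈-trans e s≈s′) (λ e → ≈-trans e (≈-sym s≈s′))) (sym (#multisets-[] s′)))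
  #multisets-cong []       (suc m) s≈s′ = refl
  #multisets-cong (x ∷ xs) zero    s≈s′ = #multisets-cong xs zero s≈s′
  #multisets-cong (x ∷ xs) (suc m) {s} {s′} s≈s′ = trans (#multisets-∷ x xs m s)
    (trans (cong₂ ℤ._+_ (#multisets-cong xs (suc m) s≈s′) (#multisets-cong (x ∷ xs) m (∙-congʳ s≈s′)))
           (sym (#multisets-∷ x xs m s′)))

  #multisets-∷-cong : ∀ {x y xs ys} → x ≈ y → (∀ m s → #multisets xs m s ≡ #multisets ys m s) →
                      ∀ m s → #multisets (x ∷ xs) m s ≡ #multisets (y ∷ ys) m s
  #multisets-∷-cong x≈y xs≗ys zero    s = xs≗ys zero s
  #multisets-∷-cong {x} {y} {xs} {ys} x≈y xs≗ys (suc m) s = trans (#multisets-∷ x xs m s) (trans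
    (cong₂ ℤ._+_ (xs≗ys (suc m) s)
      (trans (#multisets-∷-cong x≈y xs≗ys m (s - x)) (#multisets-cong (y ∷ ys) m (∙-congˡ (⁻¹-cong x≈y)))))
    (sym (#multisets-∷ y ys m s)))

  -- The recursion handles the generators one after another, so independence of their order needs a
  -- proof. It is by induction on the size: removing x and then y leaves the same sum as removing y
  -- and then x.
  #multisets-swap : ∀ x y xs m s → #multisets (x ∷ y ∷ xs) m s ≡ #multisets (y ∷ x ∷ xs) m s
  #multisets-swap x y xs zero    s = refl
  #multisets-swap x y xs (suc m) s = begin
    #multisets (x ∷ y ∷ xs) (suc m) s ≡⟨ expand x y ⟩
    u ℤ.+ v₀ ℤ.+ v₁                   ≡⟨ ℤ.+-assoc u v₀ v₁ ⟩
    u ℤ.+ (v₀ ℤ.+ v₁)                 ≡⟨ cong (λ z → u ℤ.+ z) (exchange m) ⟩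
    u ℤ.+ (w₀ ℤ.+ w₁)                 ≡⟨ ℤ.+-assoc u w₀ w₁ ⟨
    u ℤ.+ w₀ ℤ.+ w₁                   ≡⟨ expand y x ⟨
    #multisets (y ∷ x ∷ xs) (suc m) s ∎
    where
    open ≡.≡-Reasoning
    u v₀ v₁ w₀ w₁ : ℤ
    u  = #multisets xs (suc m) s
    v₀ = #multisets (y ∷ xs) m (s - y)
    v₁ = #multisets (x ∷ y ∷ xs) m (s - x)
    w₀ = #multisets (x ∷ xs) m (s - x)
    w₁ = #multisets (y ∷ x ∷ xs) m (s - y)

    expand : ∀ x y → #multisets (x ∷ y ∷ xs) (suc m) s ≡
                     u ℤ.+ #multisets (y ∷ xs) m (s - y) ℤ.+ #multisets (x ∷ y ∷ xs) m (s - x)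
    expand x y = trans (#multisets-∷ x (y ∷ xs) m s)
      (cong (λ z → z ℤ.+ #multisets (x ∷ y ∷ xs) m (s - x)) (#multisets-∷ y xs m s))

    exchange : ∀ m → #multisets (y ∷ xs) m (s - y) ℤ.+ #multisets (x ∷ y ∷ xs) m (s - x) ≡
                     #multisets (x ∷ xs) m (s - x) ℤ.+ #multisets (y ∷ x ∷ xs) m (s - y)
    exchange zero    = ℤ.+-comm (#multisets xs zero (s - y)) (#multisets xs zero (s - x))
    exchange (suc m) = begin
      v ℤ.+ #multisets (x ∷ y ∷ xs) (suc m) (s - x)
        ≡⟨ cong (λ z → v ℤ.+ z) (trans (#multisets-swap x y xs (suc m) (s - x)) (#multisets-∷ y (x ∷ xs) m (s - x))) ⟩
      v ℤ.+ (w ℤ.+ #multisets (y ∷ x ∷ xs) m (s - x - y))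
        ≡⟨ +-left-comm v w (#multisets (y ∷ x ∷ xs) m (s - x - y)) ⟩
      w ℤ.+ (v ℤ.+ #multisets (y ∷ x ∷ xs) m (s - x - y))
        ≡⟨ cong (λ z → w ℤ.+ (v ℤ.+ z)) (trans (sym (#multisets-swap x y xs m (s - x - y)))
                                               (#multisets-cong (x ∷ y ∷ xs) m (minus-comm s x y))) ⟩
      w ℤ.+ (v ℤ.+ #multisets (x ∷ y ∷ xs) m (s - y - x))
        ≡⟨ cong (λ z → w ℤ.+ z) (trans (sym (#multisets-∷ x (y ∷ xs) m (s - y)))
                                       (#multisets-swap x y xs (suc m) (s - y))) ⟩
      w ℤ.+ #multisets (y ∷ x ∷ xs) (suc m) (s - y) ∎
      where
      v w : ℤ
      v = #multisets (y ∷ xs) (suc m) (s - y)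
      w = #multisets (x ∷ xs) (suc m) (s - x)

  #multisets-↭ : ∀ {xs ys} → xs ↭ ys → ∀ m s → #multisets xs m s ≡ #multisets ys m s
  #multisets-↭ (≋⇒↭ [])        m s = refl
  #multisets-↭ (≋⇒↭ (x≈y ∷ r)) m s = #multisets-∷-cong x≈y (#multisets-↭ (≋⇒↭ r)) m s
  #multisets-↭ (prep x≈y r)    m s = #multisets-∷-cong x≈y (#multisets-↭ r) m s
  #multisets-↭ {x ∷ y ∷ xs} (swap x≈x′ y≈y′ r) m s = trans (#multisets-swap x y xs m s)
    (#multisets-∷-cong y≈y′ (#multisets-∷-cong x≈x′ (#multisets-↭ r)) m s)
  #multisets-↭ (r ⨾ r′)        m s = trans (#multisets-↭ r m s) (#multisets-↭ r′ m s)

  translate-minus : ∀ {s s′} x t u → s′ ≈ s ∙ (t ∙ u) → s′ - (x ∙ t) ≈ (s - x) ∙ u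
  translate-minus {s} {s′} x t u eq = ≈-sym (∙⇒minus (≈-trans (interchange x t (s - x) u)
    (≈-trans (∙-congʳ (minus⇒∙ ≈-refl)) (≈-sym eq))))

  -- Adding t to every term moves the sum by m · t. The new sum is a variable with an equation so
  -- that the induction hypothesis fits both branches of the recursion.
  #multisets-translate : ∀ t xs m {s s′} → s′ ≈ s ∙ (m · t) → #multisets (map (_∙ t) xs) m s′ ≡ #multisets xs m s
  #multisets-translate t []       zero    {s} eq = #multisets-cong [] zero (≈-trans eq (identityʳ s))
  #multisets-translate t []       (suc m) eq = refl
  #multisets-translate t (x ∷ xs) zero    eq = #multisets-translate t xs zero eq
  #multisets-translate t (x ∷ xs) (suc m) {s} {s′} eq = trans (#multisets-∷ (x ∙ t) (map (_∙ t) xs) m s′) (trans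
    (cong₂ ℤ._+_ (#multisets-translate t xs (suc m) eq)
                 (#multisets-translate t (x ∷ xs) m (translate-minus x t (m · t) eq)))
    (sym (#multisets-∷ x xs m s)))

  -- Summing over s drops the condition on the sum: the shift by x is absorbed by the sum over G,
  -- and what remains is the recursion of `multichoose`.
  ∑-#multisets : ∀ xs m → ∑ universe (#multisets xs m) ≡ + multichoose (length xs) m
  ∑-#multisets []       zero    = trans (∑-cong universe #multisets-[]) (∑-universe-𝟙 ε)
  ∑-#multisets []       (suc m) = ∑-zero universe (λ _ → refl)
  ∑-#multisets (x ∷ xs) zero    = ∑-#multisets xs zero
  ∑-#multisets (x ∷ xs) (suc m) = begin
    ∑ universe (#multisets (x ∷ xs) (suc m))
      ≡⟨ ∑-cong universe (#multisets-∷ x xs m) ⟩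
    ∑ universe (λ s → #multisets xs (suc m) s ℤ.+ #multisets (x ∷ xs) m (s - x))
      ≡⟨ ∑-+ universe _ _ ⟩
    ∑ universe (#multisets xs (suc m)) ℤ.+ ∑ universe (λ s → #multisets (x ∷ xs) m (s - x))
      ≡⟨ cong₂ ℤ._+_ (∑-#multisets xs (suc m))
           (trans (∑-universe-translate _ (#multisets-cong (x ∷ xs) m) x) (∑-#multisets (x ∷ xs) m)) ⟩
    + multichoose (length xs) (suc m) ℤ.+ + multichoose (suc (length xs)) m
      ≡⟨ ℤ.pos-+ (multichoose (length xs) (suc m)) _ ⟨
    + multichoose (suc (length xs)) (suc m) ∎
    where open ≡.≡-Reasoning

  order*#multisets : ∀ m → gcd m (order G) ≡ 1 →
                     order G ℕ.* length (multisets universe m ε) ≡ multichoose (order G) m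
  order*#multisets m coprime = ℤ.+-injective (trans (ℤ.pos-* (order G) _) (trans
    (sym (∑-uniform {m} (#multisets universe m) (#multisets-cong universe m)
      (λ t s → trans (sym (#multisets-↭ (universe-translate t) m (s ∙ (m · t)))) (#multisets-translate t universe m ≈-refl))
      coprime))
    (trans (∑-#multisets universe m) (cong (λ n → + multichoose n m) length-universe))))

  -- Subsets with prescribed size and sum

  #sublists : List Carrier → ℕ → Carrier → ℤ
  #sublists []       zero    s = 𝟙 (ε ≈? s)
  #sublists []       (suc k) s = 0ℤ
  #sublists (x ∷ xs) zero    s = #sublists xs zero s
  #sublists (x ∷ xs) (suc k) s = #sublists xs (suc k) s ℤ.+ #sublists xs k (s - x)

  #sublists-cong : ∀ xs k {s s′} → s ≈ s′ → #sublists xs k s ≡ #sublists xs k s′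
  #sublists-cong []       zero    {s} {s′} s≈s′ =
    𝟙-cong (ε ≈? s) (ε ≈? s′) (λ e → ≈-trans e s≈s′) (λ e → ≈-trans e (≈-sym s≈s′))
  #sublists-cong []       (suc k) s≈s′ = refl
  #sublists-cong (x ∷ xs) zero    s≈s′ = #sublists-cong xs zero s≈s′
  #sublists-cong (x ∷ xs) (suc k) s≈s′ =
    cong₂ ℤ._+_ (#sublists-cong xs (suc k) s≈s′) (#sublists-cong xs k (∙-congʳ s≈s′))

  #sublists-∷-cong : ∀ {x y xs ys} → x ≈ y → (∀ k s → #sublists xs k s ≡ #sublists ys k s) →
                     ∀ k s → #sublists (x ∷ xs) k s ≡ #sublists (y ∷ ys) k s
  #sublists-∷-cong x≈y xs≗ys zero    s = xs≗ys zero s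
  #sublists-∷-cong {x} {ys = ys} x≈y xs≗ys (suc k) s =
    cong₂ ℤ._+_ (xs≗ys (suc k) s) (trans (xs≗ys k (s - x)) (#sublists-cong ys k (∙-congˡ (⁻¹-cong x≈y))))

  #sublists-swap : ∀ x y xs k s → #sublists (x ∷ y ∷ xs) k s ≡ #sublists (y ∷ x ∷ xs) k s
  #sublists-swap x y xs zero          s = refl
  #sublists-swap x y xs (suc zero)    s =
    rearrange (#sublists xs 1 s) (#sublists xs 0 (s - y)) (#sublists xs 0 (s - x))
    where
    rearrange : ∀ p q r → p ℤ.+ q ℤ.+ r ≡ p ℤ.+ r ℤ.+ q
    rearrange = solve-∀
  #sublists-swap x y xs (suc (suc k)) s = trans
    (+-interchange (#sublists xs (suc (suc k)) s) (#sublists xs (suc k) (s - y)) (#sublists xs (suc k) (s - x))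
                   (#sublists xs k (s - x - y)))
    (cong (λ z → #sublists xs (suc (suc k)) s ℤ.+ #sublists xs (suc k) (s - x) ℤ.+ (#sublists xs (suc k) (s - y) ℤ.+ z))
      (#sublists-cong xs k (minus-comm s x y)))

  #sublists-↭ : ∀ {xs ys} → xs ↭ ys → ∀ k s → #sublists xs k s ≡ #sublists ys k s
  #sublists-↭ (≋⇒↭ [])        k s = refl
  #sublists-↭ (≋⇒↭ (x≈y ∷ r)) k s = #sublists-∷-cong x≈y (#sublists-↭ (≋⇒↭ r)) k s
  #sublists-↭ (prep x≈y r)    k s = #sublists-∷-cong x≈y (#sublists-↭ r) k s
  #sublists-↭ {x ∷ y ∷ xs} (swap x≈x′ y≈y′ r) k s = trans (#sublists-swap x y xs k s)
    (#sublists-∷-cong y≈y′ (#sublists-∷-cong x≈x′ (#sublists-↭ r)) k s)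
  #sublists-↭ (r ⨾ r′)        k s = trans (#sublists-↭ r k s) (#sublists-↭ r′ k s)

  #sublists-translate : ∀ t xs k {s s′} → s′ ≈ s ∙ (k · t) → #sublists (map (_∙ t) xs) k s′ ≡ #sublists xs k s
  #sublists-translate t []       zero    {s} eq = #sublists-cong [] zero (≈-trans eq (identityʳ s))
  #sublists-translate t []       (suc k) eq = refl
  #sublists-translate t (x ∷ xs) zero    eq = #sublists-translate t xs zero eq
  #sublists-translate t (x ∷ xs) (suc k) eq = cong₂ ℤ._+_ (#sublists-translate t xs (suc k) eq)
    (#sublists-translate t xs k (translate-minus x t (k · t) eq))

  ∑-#sublists : ∀ xs k → ∑ universe (#sublists xs k) ≡ + (length xs C k)
  ∑-#sublists []       zero    = ∑-universe-𝟙 ε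
  ∑-#sublists []       (suc k) = ∑-zero universe (λ _ → refl)
  ∑-#sublists (x ∷ xs) zero    = trans (∑-#sublists xs zero)
    (cong +_ (trans (nC0≡1 (length xs)) (sym (nC0≡1 (suc (length xs))))))
  ∑-#sublists (x ∷ xs) (suc k) = begin
    ∑ universe (λ s → #sublists xs (suc k) s ℤ.+ #sublists xs k (s - x))
      ≡⟨ ∑-+ universe _ _ ⟩
    ∑ universe (#sublists xs (suc k)) ℤ.+ ∑ universe (λ s → #sublists xs k (s - x))
      ≡⟨ cong₂ ℤ._+_ (∑-#sublists xs (suc k)) (trans (∑-universe-translate _ (#sublists-cong xs k) x) (∑-#sublists xs k)) ⟩
    + (length xs C suc k) ℤ.+ + (length xs C k)
      ≡⟨ cong +_ (trans (ℕ.+-comm (length xs C suc k) _) (nCk+nC[k+1]≡[n+1]C[k+1] (length xs) k)) ⟩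
    + (suc (length xs) C suc k) ∎
    where open ≡.≡-Reasoning

  -- `elements G` with any map e in place of the enumeration of G, because removing the first index
  -- replaces e by `e ∘ suc`.
  elementsOf : ∀ {n} → (Fin n → Carrier) → Subset n → List Carrier
  elementsOf e S = map e (filter (_∈? S) (allFin _))

  map-filter-suc : ∀ {n} (e : Fin (suc n) → Carrier) b S → map e (filter (_∈? (b ∷ S)) (tabulate suc)) ≡ elementsOf (e ∘ suc) S
  map-filter-suc e b S = trans
    (cong (map e) (trans (cong (filter _) (sym (List.map-tabulate id suc))) (filter-∈-suc b S (allFin _))))
    (sym (List.map-∘ (filter (_∈? S) (allFin _))))

  elementsOf-outside : ∀ {n} (e : Fin (suc n) → Carrier) S → elementsOf e (outside ∷ S) ≡ elementsOf (e ∘ suc) S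
  elementsOf-outside e S = map-filter-suc e outside S

  elementsOf-inside : ∀ {n} (e : Fin (suc n) → Carrier) S → elementsOf e (inside ∷ S) ≡ e zero ∷ elementsOf (e ∘ suc) S
  elementsOf-inside e S = cong (e zero ∷_) (map-filter-suc e inside S)

  IsSubset : ∀ {n} → (Fin n → Carrier) → ℕ → Carrier → Subset n → Set _
  IsSubset e k s S = ∣ S ∣ ≡ k × σ G (elementsOf e S) ≈ s

  subsets : ∀ {n} → (Fin n → Carrier) → ℕ → Carrier → List (Subset n)
  subsets {zero}  e zero    s with ε ≈? s
  ... | yes _ = [] ∷ []
  ... | no  _ = []
  subsets {zero}  e (suc k) s = []
  subsets {suc n} e zero    s = map (outside ∷_) (subsets (e ∘ suc) zero s)
  subsets {suc n} e (suc k) s =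
    map (outside ∷_) (subsets (e ∘ suc) (suc k) s) ++ map (inside ∷_) (subsets (e ∘ suc) k (s - e zero))

  outside-sound : ∀ {n} (e : Fin (suc n) → Carrier) {k s S} → IsSubset (e ∘ suc) k s S → IsSubset e k s (outside ∷ S)
  outside-sound e {S = S} (card , sum) = card , ≈-trans (≈-reflexive (cong (σ G) (elementsOf-outside e S))) sum

  inside-sound : ∀ {n} (e : Fin (suc n) → Carrier) {k s S} → IsSubset (e ∘ suc) k (s - e zero) S →
                 IsSubset e (suc k) s (inside ∷ S)
  inside-sound e {S = S} (card , sum) = cong suc card ,
    ≈-trans (≈-reflexive (cong (σ G) (elementsOf-inside e S))) (minus⇒∙ sum)

  subsets-sound : ∀ {n} (e : Fin n → Carrier) k s → All (IsSubset e k s) (subsets e k s)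
  subsets-sound {zero}  e zero    s with ε ≈? s
  ... | yes ε≈s = (refl , ε≈s) ∷ []
  ... | no  _   = []
  subsets-sound {zero}  e (suc k) s = []
  subsets-sound {suc n} e zero    s = Allₚ.map⁺ (All.map (outside-sound e) (subsets-sound (e ∘ suc) zero s))
  subsets-sound {suc n} e (suc k) s = Allₚ.++⁺
    (Allₚ.map⁺ (All.map (outside-sound e) (subsets-sound (e ∘ suc) (suc k) s)))
    (Allₚ.map⁺ (All.map (inside-sound e) (subsets-sound (e ∘ suc) k (s - e zero))))

  subsets-unique : ∀ {n} (e : Fin n → Carrier) k s → UniqueSetoid.Unique (≡.setoid (Subset n)) (subsets e k s)
  subsets-unique {zero}  e zero    s with ε ≈? s
  ... | yes _ = [] ∷ []
  ... | no  _ = []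
  subsets-unique {zero}  e (suc k) s = []
  subsets-unique {suc n} e zero    s = Unique.map⁺ Vec.∷-injectiveʳ (subsets-unique (e ∘ suc) zero s)
  subsets-unique {suc n} e (suc k) s = AllPairsₚ.++⁺
    (Unique.map⁺ Vec.∷-injectiveʳ (subsets-unique (e ∘ suc) (suc k) s))
    (Unique.map⁺ Vec.∷-injectiveʳ (subsets-unique (e ∘ suc) k (s - e zero)))
    (Allₚ.map⁺ (All.universal (λ _ → Allₚ.map⁺ (All.universal (λ _ ()) _)) _))

  subsets-complete : ∀ {n} (e : Fin n → Carrier) k s {S} → IsSubset e k s S → S ∈ subsets e k s
  subsets-complete {zero}  e zero    s {[]} (_ , ε≈s) with ε ≈? s
  ... | yes _   = here refl
  ... | no  ε≉s = contradiction ε≈s ε≉s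
  subsets-complete {zero}  e (suc k) s {[]} (() , _)
  subsets-complete {suc n} e zero    s {outside ∷ S} (card , sum) = ∈-map⁺ (outside ∷_)
    (subsets-complete (e ∘ suc) zero s (card , ≈-trans (≈-reflexive (cong (σ G) (sym (elementsOf-outside e S)))) sum))
  subsets-complete {suc n} e (suc k) s {outside ∷ S} (card , sum) = Anyₚ.++⁺ˡ (∈-map⁺ (outside ∷_)
    (subsets-complete (e ∘ suc) (suc k) s (card , ≈-trans (≈-reflexive (cong (σ G) (sym (elementsOf-outside e S)))) sum)))
  subsets-complete {suc n} e (suc k) s {inside ∷ S} (card , sum) = Anyₚ.++⁺ʳ _ (∈-map⁺ (inside ∷_)
    (subsets-complete (e ∘ suc) k (s - e zero) (ℕ.suc-injective card ,
      ∙⇒minus (≈-trans (≈-reflexive (cong (σ G) (sym (elementsOf-inside e S)))) sum))))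

  -- Connects the subsets of indices, which `N` is made of, with the count over lists of elements,
  -- for which permutation and translation invariance are proved.
  length-subsets : ∀ {n} (e : Fin n → Carrier) k s → + length (subsets e k s) ≡ #sublists (tabulate e) k s
  length-subsets {zero}  e zero    s with ε ≈? s
  ... | yes _ = refl
  ... | no  _ = refl
  length-subsets {zero}  e (suc k) s = refl
  length-subsets {suc n} e zero    s = trans (cong +_ (List.length-map _ (subsets (e ∘ suc) zero s)))
    (length-subsets (e ∘ suc) zero s)
  length-subsets {suc n} e (suc k) s = trans
    (cong +_ (trans (List.length-++ (map (outside ∷_) (subsets (e ∘ suc) (suc k) s)))
      (cong₂ ℕ._+_ (List.length-map _ (subsets (e ∘ suc) (suc k) s)) (List.length-map _ (subsets (e ∘ suc) k (s - e zero))))))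
    (cong₂ ℤ._+_ (length-subsets (e ∘ suc) (suc k) s) (length-subsets (e ∘ suc) k (s - e zero)))

  N-cardinality : ∀ k → HasCardinality (N G k) (length (subsets element k ε))
  N-cardinality k = enumeration⇒cardinality (≡.setoid _) _ (subsets-unique element k ε)
    (subsets-sound element k ε) (subsets-complete element k ε)

  order*#subsets : ∀ k → gcd k (order G) ≡ 1 → order G ℕ.* length (subsets element k ε) ≡ order G C k
  order*#subsets k coprime = ℤ.+-injective (begin
    + (order G ℕ.* length (subsets element k ε))
      ≡⟨ ℤ.pos-* (order G) _ ⟩
    + order G ℤ.* + length (subsets element k ε)
      ≡⟨ cong (λ z → + order G ℤ.* z) (trans (length-subsets element k ε)
           (cong (λ xs → #sublists xs k ε) (sym (List.map-tabulate id element)))) ⟩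
    + order G ℤ.* #sublists universe k ε
      ≡⟨ ∑-uniform {k} (#sublists universe k) (#sublists-cong universe k)
           (λ t s → trans (sym (#sublists-↭ (universe-translate t) k (s ∙ (k · t)))) (#sublists-translate t universe k ≈-refl))
           coprime ⟨
    ∑ universe (#sublists universe k)
      ≡⟨ trans (∑-#sublists universe k) (cong (λ n → + (n C k)) length-universe) ⟩
    + (order G C k) ∎)
    where open ≡.≡-Reasoning

  -- A multiset of size m + 1 in which y has multiplicity v is counted v times by the summand for y:
  -- one y is removed, and the other v - 1 are distributed over the two copies of y in `y ∷ xs`. The
  -- multiplicities add up to m + 1.
  newton : ∀ xs m s → + suc m ℤ.* #multisets xs (suc m) s ≡ ∑ xs (λ y → #multisets (y ∷ xs) m (s - y))
  newton []       m       s = ℤ.*-zeroʳ (+ suc m)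
  newton (x ∷ xs) zero    s = begin
    1ℤ ℤ.* #multisets (x ∷ xs) 1 s
      ≡⟨ cong (λ z → 1ℤ ℤ.* z) (#multisets-∷ x xs 0 s) ⟩
    1ℤ ℤ.* (#multisets xs 1 s ℤ.+ #multisets xs 0 (s - x))
      ≡⟨ rearrange (#multisets xs 1 s) (#multisets xs 0 (s - x)) ⟩
    #multisets xs 0 (s - x) ℤ.+ 1ℤ ℤ.* #multisets xs 1 s
      ≡⟨ cong (λ z → #multisets xs 0 (s - x) ℤ.+ z) (newton xs 0 s) ⟩
    #multisets xs 0 (s - x) ℤ.+ ∑ xs (λ y → #multisets xs 0 (s - y)) ∎
    where
    open ≡.≡-Reasoning
    rearrange : ∀ i j → 1ℤ ℤ.* (i ℤ.+ j) ≡ j ℤ.+ 1ℤ ℤ.* i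
    rearrange = solve-∀
  newton (x ∷ xs) (suc m) s = begin
    + suc (suc m) ℤ.* #multisets (x ∷ xs) (suc (suc m)) s
      ≡⟨ cong (λ z → + suc (suc m) ℤ.* z) (#multisets-∷ x xs (suc m) s) ⟩
    (1ℤ ℤ.+ + suc m) ℤ.* (P₀ ℤ.+ Q₀)
      ≡⟨ expand (+ suc m) P₀ Q₀ ⟩
    + suc (suc m) ℤ.* P₀ ℤ.+ (Q₀ ℤ.+ + suc m ℤ.* Q₀)
      ≡⟨ cong₂ (λ i j → i ℤ.+ (Q₀ ℤ.+ j)) (newton xs (suc m) s) (newton (x ∷ xs) m (s - x)) ⟩
    ∑ xs F ℤ.+ (Q₀ ℤ.+ (T₀ ℤ.+ ∑ xs F′))
      ≡⟨ regroup (∑ xs F) Q₀ T₀ (∑ xs F′) ⟩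
    (Q₀ ℤ.+ T₀) ℤ.+ (∑ xs F ℤ.+ ∑ xs F′)
      ≡⟨ cong₂ ℤ._+_ (sym (#multisets-∷ x (x ∷ xs) m (s - x)))
           (trans (sym (∑-+ xs F F′)) (∑-cong xs λ y → trans
             (cong (λ z → F y ℤ.+ z) (trans (sym (#multisets-swap x y xs m (s - x - y)))
                                            (#multisets-cong (x ∷ y ∷ xs) m (minus-comm s x y))))
             (trans (sym (#multisets-∷ x (y ∷ xs) m (s - y))) (#multisets-swap x y xs (suc m) (s - y))))) ⟩
    #multisets (x ∷ x ∷ xs) (suc m) (s - x) ℤ.+ ∑ xs (λ y → #multisets (y ∷ x ∷ xs) (suc m) (s - y)) ∎
    where
    open ≡.≡-Reasoning
    P₀ Q₀ T₀ : ℤ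
    P₀ = #multisets xs (suc (suc m)) s
    Q₀ = #multisets (x ∷ xs) (suc m) (s - x)
    T₀ = #multisets (x ∷ x ∷ xs) m (s - x - x)
    F F′ : Carrier → ℤ
    F  y = #multisets (y ∷ xs) (suc m) (s - y)
    F′ y = #multisets (y ∷ x ∷ xs) m (s - x - y)
    expand : ∀ i j k → (1ℤ ℤ.+ i) ℤ.* (j ℤ.+ k) ≡ (1ℤ ℤ.+ i) ℤ.* j ℤ.+ (k ℤ.+ i ℤ.* k)
    expand = solve-∀
    regroup : ∀ i j k l → i ℤ.+ (j ℤ.+ (k ℤ.+ l)) ≡ (j ℤ.+ k) ℤ.+ (i ℤ.+ l)
    regroup = solve-∀

  minus-minus : ∀ s x y → s - x - y ≈ s - (x ∙ y)
  minus-minus s x y = ≈-trans (assoc s _ _) (∙-congˡ (⁻¹-∙-comm x y))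

  -- k is the number of times the additional y is taken.
  #multisets-∷-∑ : ∀ y xs m s → #multisets (y ∷ xs) m s ≡ ∑ (downFrom (suc m)) (λ k → #multisets xs (m ∸ k) (s - k · y))
  #multisets-∷-∑ y xs zero    s = trans
    (#multisets-cong xs zero (≈-sym (≈-trans (∙-congˡ ε⁻¹≈ε) (identityʳ s)))) (sym (ℤ.+-identityʳ _))
  #multisets-∷-∑ y xs (suc m) s = begin
    #multisets (y ∷ xs) (suc m) s
      ≡⟨ #multisets-∷ y xs m s ⟩
    #multisets xs (suc m) s ℤ.+ #multisets (y ∷ xs) m (s - y)
      ≡⟨ cong₂ ℤ._+_ (#multisets-cong xs (suc m) (≈-sym (≈-trans (∙-congˡ ε⁻¹≈ε) (identityʳ s))))
           (trans (#multisets-∷-∑ y xs m (s - y))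
                  (∑-cong (downFrom (suc m)) λ k → #multisets-cong xs (m ∸ k) (minus-minus s y (k · y)))) ⟩
    #multisets xs (suc m) (s - ε) ℤ.+ ∑ (downFrom (suc m)) (λ k → #multisets xs (m ∸ k) (s - suc k · y))
      ≡⟨ ∑-downFrom-suc (suc m) (λ k → #multisets xs (suc m ∸ k) (s - k · y)) ⟨
    ∑ (downFrom (suc (suc m))) (λ k → #multisets xs (suc m ∸ k) (s - k · y)) ∎
    where open ≡.≡-Reasoning

  newton-universe : ∀ m s → + suc m ℤ.* #multisets universe (suc m) s ≡
                    ∑ (downFrom (suc m)) (λ k → ∑ universe (λ y → #multisets universe (m ∸ k) (s - suc k · y)))
  newton-universe m s = trans (newton universe m s) (trans
    (∑-cong universe λ y → trans (#multisets-∷-∑ y universe m (s - y))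
      (∑-cong (downFrom (suc m)) λ k → #multisets-cong universe (m ∸ k) (minus-minus s y (k · y))))
    (∑-swap universe (downFrom (suc m)) _))

  #multisets-zero : ∀ xs s → #multisets xs 0 s ≡ 𝟙 (ε ≈? s)
  #multisets-zero []       s = #multisets-[] s
  #multisets-zero (x ∷ xs) s = #multisets-zero xs s

  -- u d stands for the sum of the characters of G of order dividing d, so that its Möbius inverse χ d is the sum
  -- of those of order d; averaging χ d over a coset s + kG is then the orthogonality of characters.
  module Characters
    (n : ℕ) (0<n : 0 < n) (n∣order : n ∣ order G) (u : ℕ → Carrier → ℤ)
    (u-n : ∀ s → u n s ≡ + order G ℤ.* 𝟙 (ε ≈? s))
    (u-average : ∀ d → 0 < d → d ∣ n → ∀ k s → ∑ universe (λ y → u d (s - k · y)) ≡ + order G ℤ.* u (gcd k d) s)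
    where

    χ : ℕ → Carrier → ℤ
    χ d s = invert (λ e → u e s) d

    -- A character of order d sums to 0 over the multiples k · y unless it is trivial on them, that
    -- is, unless d ∣ k. For the proof both sides are summed over the divisors of d: the left side
    -- becomes a sum of values of `u d`, the right side `u` at gcd(k, d).
    χ-average : ∀ k s d → 0 < d → d ∣ n →
                ∑ universe (λ y → χ d (s - k · y)) ≡ + order G ℤ.* (𝟙 (d ∣? k) ℤ.* χ d s)
    χ-average k s = ∑-divisors-injective n _ _ λ d 0<d d∣n → begin
      ∑ (divisors d) (λ e → ∑ universe (λ y → χ e (s - k · y)))
        ≡⟨ ∑-swap (divisors d) universe _ ⟩
      ∑ universe (λ y → ∑ (divisors d) (λ e → χ e (s - k · y)))
        ≡⟨ ∑-cong universe (λ y → ∑-divisors-invert _ d 0<d) ⟩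
      ∑ universe (λ y → u d (s - k · y))
        ≡⟨ u-average d 0<d d∣n k s ⟩
      + order G ℤ.* u (gcd k d) s
        ≡⟨ cong (λ z → + order G ℤ.* z) (∑-divisors-invert _ (gcd k d) (0<gcd k d 0<d)) ⟨
      + order G ℤ.* ∑ (divisors (gcd k d)) (λ e → χ e s)
        ≡⟨ cong (λ z → + order G ℤ.* z) (∑-divisors-gcd k d 0<d _) ⟩
      + order G ℤ.* ∑ (divisors d) (λ e → 𝟙 (e ∣? k) ℤ.* χ e s)
        ≡⟨ *-distribˡ-∑ (+ order G) (divisors d) _ ⟩
      ∑ (divisors d) (λ e → + order G ℤ.* (𝟙 (e ∣? k) ℤ.* χ e s)) ∎
      where open ≡.≡-Reasoning

    -- Strong induction on m. At 0 the χ d add up to `u n`. At m + 1 Newton's identity produces sums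
    -- of χ d over s - (k + 1) · y; orthogonality keeps the k with d ∣ k + 1, and `coefficient-step`
    -- evaluates what is left before m + 1 is cancelled.
    order*#multisets≡∑ : ∀ m s → + order G ℤ.* #multisets universe m s ≡
                         ∑ (divisors n) (λ d → χ d s ℤ.* coefficient (order G) d m)
    order*#multisets≡∑ = <-rec _ λ
      { zero    _   s → begin
          + order G ℤ.* #multisets universe 0 s
            ≡⟨ cong (λ z → + order G ℤ.* z) (#multisets-zero universe s) ⟩
          + order G ℤ.* 𝟙 (ε ≈? s)
            ≡⟨ u-n s ⟨
          u n s
            ≡⟨ ∑-divisors-invert _ n 0<n ⟨
          ∑ (divisors n) (λ d → χ d s)
            ≡⟨ ∑-cong-∈ (divisors n) (λ {d} d∈ → let 0<d , d∣n = ∈-divisors⁻ {n} d∈ in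
                 trans (sym (ℤ.*-identityʳ (χ d s)))
                   (cong (λ z → χ d s ℤ.* z) (sym (coefficient-zero (order G) d {{ℕ.>-nonZero 0<d}} (∣-trans d∣n n∣order))))) ⟩
          ∑ (divisors n) (λ d → χ d s ℤ.* coefficient (order G) d 0) ∎
      ; (suc m) rec s → ℤ.*-cancelˡ-≡ (+ suc m) _ _ (step m (λ {i} → rec {i}) s) }
      where
      open ≡.≡-Reasoning
      g : ℤ
      g = + order G

      coeff : ℕ → ℕ → ℤ
      coeff d m = coefficient (order G) d m

      rearrange : ∀ i j k l → i ℤ.* (j ℤ.* k) ℤ.* l ≡ k ℤ.* (i ℤ.* (j ℤ.* l))
      rearrange = solve-∀

      step : ∀ m → (∀ {i} → i < suc m → ∀ s → g ℤ.* #multisets universe i s ≡ ∑ (divisors n) (λ d → χ d s ℤ.* coeff d i)) →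
             ∀ s → + suc m ℤ.* (g ℤ.* #multisets universe (suc m) s) ≡
                  + suc m ℤ.* ∑ (divisors n) (λ d → χ d s ℤ.* coeff d (suc m))
      step m rec s = begin
        + suc m ℤ.* (g ℤ.* #multisets universe (suc m) s)
          ≡⟨ *-left-comm (+ suc m) g (#multisets universe (suc m) s) ⟩
        g ℤ.* (+ suc m ℤ.* #multisets universe (suc m) s)
          ≡⟨ cong (λ z → g ℤ.* z) (newton-universe m s) ⟩
        g ℤ.* ∑ (downFrom (suc m)) (λ k → ∑ universe (λ y → #multisets universe (m ∸ k) (s - suc k · y)))
          ≡⟨ trans (*-distribˡ-∑ g (downFrom (suc m)) _) (∑-cong (downFrom (suc m)) λ k → *-distribˡ-∑ g universe _) ⟩
        ∑ (downFrom (suc m)) (λ k → ∑ universe (λ y → g ℤ.* #multisets universe (m ∸ k) (s - suc k · y)))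
          ≡⟨ ∑-cong (downFrom (suc m)) (λ k → ∑-cong universe λ y → rec (ℕ.s≤s (ℕ.m∸n≤m m k)) (s - suc k · y)) ⟩
        ∑ (downFrom (suc m)) (λ k → ∑ universe (λ y → ∑ (divisors n) (λ d → χ d (s - suc k · y) ℤ.* coeff d (m ∸ k))))
          ≡⟨ ∑-cong (downFrom (suc m)) (λ k → trans (∑-swap universe (divisors n) _)
               (∑-cong-∈ (divisors n) λ {d} d∈ → let 0<d , d∣n = ∈-divisors⁻ {n} d∈ in
                 trans (sym (*-distribʳ-∑ (coeff d (m ∸ k)) universe _))
                   (trans (cong (λ z → z ℤ.* coeff d (m ∸ k)) (χ-average (suc k) s d 0<d d∣n))
                   (rearrange g (𝟙 (d ∣? suc k)) (χ d s) (coeff d (m ∸ k)))))) ⟩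
        ∑ (downFrom (suc m)) (λ k → ∑ (divisors n) (λ d → χ d s ℤ.* (g ℤ.* (𝟙 (d ∣? suc k) ℤ.* coeff d (m ∸ k)))))
          ≡⟨ ∑-swap (downFrom (suc m)) (divisors n) _ ⟩
        ∑ (divisors n) (λ d → ∑ (downFrom (suc m)) (λ k → χ d s ℤ.* (g ℤ.* (𝟙 (d ∣? suc k) ℤ.* coeff d (m ∸ k)))))
          ≡⟨ ∑-cong-∈ (divisors n) (λ {d} d∈ → let 0<d , d∣n = ∈-divisors⁻ {n} d∈ in
               trans (sym (*-distribˡ-∑ (χ d s) (downFrom (suc m)) _))
                 (trans (cong (λ z → χ d s ℤ.* z) (trans (sym (*-distribˡ-∑ g (downFrom (suc m)) _))
                           (sym (coefficient-step 0<d (∣-trans d∣n n∣order) (suc m)))))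
                   (*-left-comm (χ d s) (+ suc m) (coeff d (suc m))))) ⟩
        ∑ (divisors n) (λ d → + suc m ℤ.* (χ d s ℤ.* coeff d (suc m)))
          ≡⟨ *-distribˡ-∑ (+ suc m) (divisors n) _ ⟨
        + suc m ℤ.* ∑ (divisors n) (λ d → χ d s ℤ.* coeff d (suc m)) ∎

-- The groups Cₙʳ

coefficient-∤ˡ : ∀ g d m → ¬ d ∣ g → coefficient g d m ≡ 0ℤ
coefficient-∤ˡ g d m ∤ with d ∣? g | d ∣? m
... | yes d∣g | _ = contradiction d∣g ∤
... | no  _   | _ = refl

n∣n^r : ∀ n r .{{_ : NonZero r}} → n ∣ n ^ r
n∣n^r n (suc r) = m∣m*n (n ^ r)

-- The number of elements of order d in Cₙʳ, for any multiple n of d.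
jordan : ℕ → ℕ → ℤ
jordan r = invert (λ d → + (d ^ r))

module CyclicPowerCount (G : FiniteAbelianGroup a ℓ) (n r : ℕ) .{{_ : NonZero n}} .{{_ : NonZero r}}
                        (G≅ : FiniteAbelianGroup.abelianGroup G ≅ CyclicPower n r) where
  open FiniteAbelianGroup G hiding (order) renaming (refl to ≈-refl; sym to ≈-sym; trans to ≈-trans; reflexive to ≈-reflexive)
  open Counting G
  open Algebra.Properties.Monoid.Mult monoid renaming (_×_ to _·_)
  private
    module P = AbelianGroup (CyclicPower n r)
  open GroupMorphisms rawGroup P.rawGroup using (module IsGroupIsomorphism)

  f : Carrier → Fin r → ℤ
  f = proj₁ G≅

  open IsGroupIsomorphism (proj₂ G≅) using (⟦⟧-cong; ∙-homo; ε-homo; ⁻¹-homo; injective; surjective)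

  -- Along f, sums over G become sums over the box; comparing lengths gives the order of G as well.
  image↭box : Permutation._↭_ P.setoid (map f universe) (box r n)
  image↭box = unique⇒↭ P.setoid (UniqueSetoidₚ.map⁺ setoid P.setoid injective universe-unique) (box-unique n r)
    (λ {z} _ → ∈-box n r z)
    (λ {z} _ → let x , fx≈z = surjective z in
      SetoidMembershipₚ.∈-resp-≈ P.setoid {x = f x} {z} (fx≈z ≈-refl)
        (SetoidMembershipₚ.∈-map⁺ setoid P.setoid ⟦⟧-cong (∈-universe x)))

  order≡n^r : order G ≡ n ^ r
  order≡n^r = trans (sym (trans (List.length-map f universe) length-universe))
    (trans (Permutationₚ.xs↭ys⇒|xs|≡|ys| P.setoid image↭box) (length-box n r))

  scale : ℕ → (Fin r → ℤ) → Fin r → ℤ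
  scale k v i = + k ℤ.* v i

  f-· : ∀ k y → f (k · y) P.≈ scale k (f y)
  f-· zero    y = ε-homo
  f-· (suc k) y = begin
    f (y ∙ k · y)         ≈⟨ ∙-homo y (k · y) ⟩
    f y P.∙ f (k · y)     ≈⟨ P.∙-cong {f y} {f y} {f (k · y)} {scale k (f y)} (P.refl {f y}) (f-· k y) ⟩
    f y P.∙ scale k (f y) ≈⟨ (λ i → AbelianGroup.reflexive (Cyclic n) (sym (ℤ.suc-* (+ k) (f y i)))) ⟩
    scale (suc k) (f y)   ∎
    where open SetoidReasoning P.setoid

  f-minus : ∀ s k y → f (s - k · y) P.≈ (λ i → f s i ℤ.- + k ℤ.* f y i)
  f-minus s k y = begin
    f (s - k · y)                   ≈⟨ ∙-homo s ((k · y) ⁻¹) ⟩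
    f s P.∙ f ((k · y) ⁻¹)          ≈⟨ P.∙-cong {f s} {f s} {f ((k · y) ⁻¹)} {scale k (f y) P.⁻¹} (P.refl {f s})
                                       (P.trans {f ((k · y) ⁻¹)} {f (k · y) P.⁻¹} {scale k (f y) P.⁻¹} (⁻¹-homo (k · y))
                                         (P.⁻¹-cong {f (k · y)} {scale k (f y)} (f-· k y))) ⟩
    f s P.∙ scale k (f y) P.⁻¹      ∎
    where open SetoidReasoning P.setoid

  u : ℕ → Carrier → ℤ
  u d s = boxWeight r d (f s)

  n∣f⇔≈ε : ∀ s → ((∀ i → + n ∣ℤ f s i) → ε ≈ s) × (ε ≈ s → ∀ i → + n ∣ℤ f s i)
  n∣f⇔≈ε s =
    (λ n∣fs → injective (P.trans {f ε} {P.ε} {f s} ε-homo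
      (P.sym {f s} {P.ε} λ i → subst (+ n ∣ℤ_) (sym (ℤ.+-identityʳ _)) (n∣fs i)))) ,
    (λ ε≈s i → subst (+ n ∣ℤ_) (ℤ.+-identityʳ _) (P.trans {f s} {f ε} {P.ε} (⟦⟧-cong (≈-sym ε≈s)) ε-homo i))

  -- The regular character: all characters of G together sum to |G| at the identity and to 0
  -- elsewhere.
  u-n : ∀ s → u n s ≡ + order G ℤ.* 𝟙 (ε ≈? s)
  u-n s with ε ≈? s
  ... | yes ε≈s = trans (boxWeight-∣ r n (proj₂ (n∣f⇔≈ε s) ε≈s)) (trans (cong +_ (sym order≡n^r)) (sym (ℤ.*-identityʳ _)))
  ... | no  ε≉s = trans (boxWeight-∤ r n (ε≉s ∘ proj₁ (n∣f⇔≈ε s))) (sym (ℤ.*-zeroʳ (+ order G)))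

  u-average : ∀ d → 0 < d → d ∣ n → ∀ k s → ∑ universe (λ y → u d (s - k · y)) ≡ + order G ℤ.* u (gcd k d) s
  u-average d 0<d d∣n k s = begin
    ∑ universe (λ y → u d (s - k · y))
      ≡⟨ ∑-cong universe (λ y → boxWeight-cong r d∣n (f-minus s k y)) ⟩
    ∑ universe (λ y → F (f y))
      ≡⟨ ∑-map f universe F ⟨
    ∑ (map f universe) F
      ≡⟨ ∑-↭ P.setoid F F-cong image↭box ⟩
    ∑ (box r n) F
      ≡⟨ ∑-boxWeight r n k d 0<d d∣n (f s) ⟩
    + (n ^ r) ℤ.* u (gcd k d) s
      ≡⟨ cong (λ N → + N ℤ.* u (gcd k d) s) order≡n^r ⟨
    + order G ℤ.* u (gcd k d) s ∎
    where
    open ≡.≡-Reasoning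
    F : (Fin r → ℤ) → ℤ
    F y = boxWeight r d (λ i → f s i ℤ.- + k ℤ.* y i)
    F-cong : ∀ {x y} → x P.≈ y → F x ≡ F y
    F-cong {x} {y} x≈y = boxWeight-cong r d∣n λ i →
      subst (+ n ∣ℤ_) (factor (f s i) (+ k) (x i) (y i)) (ℤ.∣n⇒∣m*n (ℤ.- (+ k)) (x≈y i))
      where
      factor : ∀ z k x y → ℤ.- k ℤ.* (x ℤ.- y) ≡ z ℤ.- k ℤ.* x ℤ.- (z ℤ.- k ℤ.* y)
      factor = solve-∀

  open Characters n (ℕ.>-nonZero⁻¹ n) (subst (n ∣_) (sym order≡n^r) (n∣n^r n r)) u u-n u-average

  -- At ε every character takes the value 1, so `u d` is dʳ and `χ d` is Jordan's totient, in which
  -- n no longer occurs. Two groups with the same r thus get the same weights.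
  order*#multisets≡∑jordan : ∀ m → + order G ℤ.* #multisets universe m ε ≡
                             ∑ (divisors n) (λ d → jordan r d ℤ.* coefficient (order G) d m)
  order*#multisets≡∑jordan m = trans (order*#multisets≡∑ m ε) (∑-cong-∈ (divisors n) λ {d} d∈ →
    let 0<d , d∣n = ∈-divisors⁻ {n} d∈ in cong (λ z → z ℤ.* coefficient (order G) d m)
      (invert-cong n (λ e _ e∣n → boxWeight-∣ r e λ i → ℤ.∣-trans (ℤ.∣ᵤ⇒∣ e∣n) (proj₂ (n∣f⇔≈ε ε) ≈-refl i)) d 0<d d∣n))

-- After multiplication by |G| |H|, `coefficient-swap` brings the summands of both sides to the
-- common form |G| · F d. The ranges of d differ, but F vanishes unless d divides |G| and |H|, so
-- both shrink to the divisors of gcd(|H|, n) = gcd(|G|, m).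
#zeroSum-swap : ∀ (G : FiniteAbelianGroup a ℓ) (H : FiniteAbelianGroup b p) n m r
                .{{_ : NonZero n}} .{{_ : NonZero m}} .{{_ : NonZero r}} →
                FiniteAbelianGroup.abelianGroup G ≅ CyclicPower n r → FiniteAbelianGroup.abelianGroup H ≅ CyclicPower m r →
                gcd n (m ^ r) ≡ gcd (n ^ r) m →
                length (Counting.multisets G (Counting.universe G) (order H) (FiniteAbelianGroup.ε G)) ≡
                length (Counting.multisets H (Counting.universe H) (order G) (FiniteAbelianGroup.ε H))
#zeroSum-swap G H n m r G≅ H≅ gcd≡ =
  ℤ.+-injective (ℤ.*-cancelˡ-≡ (+ g) _ _ {{order-nonZero G}} (ℤ.*-cancelˡ-≡ (+ h) _ _ {{order-nonZero H}} (begin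
  + h ℤ.* (+ g ℤ.* #G)
    ≡⟨ cong (λ z → + h ℤ.* z) (CG.order*#multisets≡∑jordan h) ⟩
  + h ℤ.* ∑ (divisors n) (λ d → jordan r d ℤ.* coefficient g d h)
    ≡⟨ *-distribˡ-∑ (+ h) (divisors n) _ ⟩
  ∑ (divisors n) (λ d → + h ℤ.* (jordan r d ℤ.* coefficient g d h))
    ≡⟨ ∑-cong (divisors n) (λ d → trans (*-left-comm (+ h) (jordan r d) (coefficient g d h)) (trans
         (cong (λ z → jordan r d ℤ.* z) (coefficient-swap g d h)) (*-left-comm (jordan r d) (+ g) (coefficient h d g)))) ⟩
  ∑ (divisors n) (λ d → + g ℤ.* (jordan r d ℤ.* coefficient h d g))
    ≡⟨ *-distribˡ-∑ (+ g) (divisors n) _ ⟨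
  + g ℤ.* ∑ (divisors n) F
    ≡⟨ cong (λ z → + g ℤ.* z) (trans (restrict n h λ d d∤h → coefficient-∤ˡ h d g d∤h)
         (trans (cong (λ N → ∑ (divisors N) F) gcd[h,n]≡gcd[g,m])
         (sym (restrict m g λ d d∤g → coefficient-∤ h d g d∤g)))) ⟩
  + g ℤ.* ∑ (divisors m) F
    ≡⟨ cong (λ z → + g ℤ.* z) (CH.order*#multisets≡∑jordan g) ⟨
  + g ℤ.* (+ h ℤ.* #H)
    ≡⟨ *-left-comm (+ g) (+ h) #H ⟩
  + h ℤ.* (+ g ℤ.* #H) ∎)))
  where
  open ≡.≡-Reasoning
  module CG = CyclicPowerCount G n r G≅
  module CH = CyclicPowerCount H m r H≅
  g h : ℕ
  g = order G
  h = order H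
  #G #H : ℤ
  #G = Counting.#multisets G (Counting.universe G) h (FiniteAbelianGroup.ε G)
  #H = Counting.#multisets H (Counting.universe H) g (FiniteAbelianGroup.ε H)

  F : ℕ → ℤ
  F d = jordan r d ℤ.* coefficient h d g

  gcd[h,n]≡gcd[g,m] : gcd h n ≡ gcd g m
  gcd[h,n]≡gcd[g,m] = trans (gcd-comm h n) (trans (cong (gcd n) CH.order≡n^r)
    (trans gcd≡ (cong (λ N → gcd N m) (sym CG.order≡n^r))))

  restrict : ∀ n k .{{_ : NonZero n}} → (∀ d → ¬ d ∣ k → coefficient h d g ≡ 0ℤ) → ∑ (divisors n) F ≡ ∑ (divisors (gcd k n)) F
  restrict n k vanish = trans (∑-cong (divisors n) drop-indicator) (sym (∑-divisors-gcd k n (ℕ.>-nonZero⁻¹ n) F))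
    where
    drop-indicator : ∀ d → F d ≡ 𝟙 (d ∣? k) ℤ.* F d
    drop-indicator d with d ∣? k
    ... | yes _   = sym (ℤ.*-identityˡ (F d))
    ... | no  d∤k = trans (cong (λ z → jordan r d ℤ.* z) (vanish d d∤k)) (ℤ.*-zeroʳ (jordan r d))

-- From cardinalities to bijections and rational Catalan numbers

sameCardinality⇒bijection : ∀ {X : Setoid a ℓ} {Y : Setoid b p} {m n} →
                            HasCardinality X m → HasCardinality Y n → m ≡ n → Bijection X Y
sameCardinality⇒bijection |X| |Y| refl =
  Bijection.trans (Inverse.Inverse⇒Bijection (Symmetry.inverse (Bijection.Bijection⇒Inverse |X|))) |Y|

fromℕ≡/ : ∀ {n x} d .{{_ : NonZero d}} → d ℕ.* n ≡ x → fromℕ n ≡ + x / d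
fromℕ≡/ {n} (suc d) refl = ℚ.fromℚᵘ-cong {mkℚᵘ (+ n) 0} {mkℚᵘ (+ (suc d ℕ.* n)) d} (*≡* (begin
  + n ℤ.* + suc d        ≡⟨ ℤ.*-comm (+ n) (+ suc d) ⟩
  + suc d ℤ.* + n        ≡⟨ ℤ.pos-* (suc d) n ⟨
  + (suc d ℕ.* n)        ≡⟨ ℤ.*-identityʳ _ ⟨
  + (suc d ℕ.* n) ℤ.* 1ℤ ∎))
  where open ≡.≡-Reasoning

gcd-+ˡ : ∀ a b → gcd a (a ℕ.+ b) ≡ 1 → gcd a b ≡ 1
gcd-+ˡ a b coprime = coprime⇒gcd≡1 {a} {b} λ (d∣a , d∣b) → gcd≡1⇒coprime {a} {a ℕ.+ b} coprime (d∣a , ∣m∣n⇒∣m+n d∣a d∣b)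

gcd-+ʳ : ∀ a b → gcd a (a ℕ.+ b) ≡ 1 → gcd b (a ℕ.+ b) ≡ 1
gcd-+ʳ a b coprime = coprime⇒gcd≡1 {b} {a ℕ.+ b} λ {d} (d∣b , d∣a+b) →
  gcd≡1⇒coprime {a} {a ℕ.+ b} coprime (∣m+n∣m⇒∣n (subst (d ∣_) (ℕ.+-comm a b) d∣a+b) d∣b , d∣a+b)

theorem1p1 : ∀ {c₁ ℓ₁ c₂ ℓ₂} (k m n r : ℕ)
    .{{_ : NonZero k}} .{{_ : NonZero m}} .{{_ : NonZero n}} .{{_ : NonZero r}}
    (G : FiniteAbelianGroup c₁ ℓ₁) (H : FiniteAbelianGroup c₂ ℓ₂) →
    (gcd (order G) (order H) ≡ 1 →
      Bijection (M G (order H)) (M H (order G)) ×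
      Bijection (M H (order G)) (Dyck (order G) (order H)) ×
      (∃[ N₁ ] (HasCardinality (M G (order H)) N₁ ×
                HasCardinality (M H (order G)) N₁ ×
                fromℕ N₁ ≡ Cat (order G) (order H) {{order-nonZero G}})))
    ×
    (FiniteAbelianGroup.abelianGroup G ≅ CyclicPower n r →
     FiniteAbelianGroup.abelianGroup H ≅ CyclicPower m r →
     gcd n (m ^ r) ≡ gcd (n ^ r) m →
      ∃[ N₂ ] (HasCardinality (M G (order H)) N₂ ×
               HasCardinality (M H (order G)) N₂))
    ×
    (k < order G → gcd k (order G) ≡ 1 →
      Bijection (N G k) (N G (order G ∸ k)) ×
      Bijection (N G (order G ∸ k)) (Dyck k (order G ∸ k)) ×
      (∃[ N₃ ] (HasCardinality (N G k) N₃ ×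
                HasCardinality (N G (order G ∸ k)) N₃ ×
                fromℕ N₃ ≡ (+ (order G C k) / order G) {{order-nonZero G}} ×
                (+ (order G C k) / order G) {{order-nonZero G}} ≡ Cat k (order G ∸ k))))
theorem1p1 k m n r G H = part₁ , part₂ , part₃
  where
  module CG = Counting G
  module CH = Counting H

  g h : ℕ
  g = order G
  h = order H

  0<g : 0 < g
  0<g = ℕ.>-nonZero⁻¹ g {{order-nonZero G}}

  0<h : 0 < h
  0<h = ℕ.>-nonZero⁻¹ h {{order-nonZero H}}

  #MG #MH : ℕ
  #MG = length (CG.multisets CG.universe h (FiniteAbelianGroup.ε G))
  #MH = length (CH.multisets CH.universe g (FiniteAbelianGroup.ε H))

  positive-sum : ∀ a b → 0 < a → NonZero (a ℕ.+ b)
  positive-sum a b 0<a = ℕ.>-nonZero (ℕ.≤-trans 0<a (ℕ.m≤m+n a b))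

  part₁ : gcd g h ≡ 1 → _
  part₁ coprime =
    sameCardinality⇒bijection {X = M G h} {M H g} |MG| |MH| #MG≡#MH ,
    sameCardinality⇒bijection {X = M H g} {Dyck g h} |MH| Dyck-cardinality #MH≡#Dyck ,
    #MG , |MG| , subst (HasCardinality (M H g)) (sym #MG≡#MH) |MH| ,
    fromℕ≡/ (g ℕ.+ h) {{positive-sum g h 0<g}} [g+h]*#MG
    where
    open CycleLemma g h {{order-nonZero G}} coprime
    |MG| = CG.M-cardinality h
    |MH| = CH.M-cardinality g

    [g+h]*#MG : (g ℕ.+ h) ℕ.* #MG ≡ (g ℕ.+ h) C g
    [g+h]*#MG = +-*-multichoose g h #MG 0<g (Counting.order*#multisets G h (trans (gcd-comm h g) coprime))

    [g+h]*#MH : (g ℕ.+ h) ℕ.* #MH ≡ (g ℕ.+ h) C g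
    [g+h]*#MH = begin
      (g ℕ.+ h) ℕ.* #MH   ≡⟨ cong (ℕ._* #MH) (ℕ.+-comm g h) ⟩
      (h ℕ.+ g) ℕ.* #MH   ≡⟨ +-*-multichoose h g #MH 0<h (Counting.order*#multisets H g coprime) ⟩
      (h ℕ.+ g) C h       ≡⟨ cong (_C h) (ℕ.+-comm h g) ⟩
      (g ℕ.+ h) C h       ≡⟨ nCk≡nC[n∸k] (ℕ.m≤n+m h g) ⟩
      (g ℕ.+ h) C (g ℕ.+ h ∸ h) ≡⟨ cong ((g ℕ.+ h) C_) (ℕ.m+n∸n≡m g h) ⟩
      (g ℕ.+ h) C g       ∎
      where open ≡.≡-Reasoning

    #MG≡#MH : #MG ≡ #MH
    #MG≡#MH = ℕ.*-cancelˡ-≡ _ _ (g ℕ.+ h) {{positive-sum g h 0<g}} (trans [g+h]*#MG (sym [g+h]*#MH))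

    #MH≡#Dyck : #MH ≡ length dyckPaths
    #MH≡#Dyck = ℕ.*-cancelˡ-≡ _ _ (g ℕ.+ h) {{positive-sum g h 0<g}} (trans [g+h]*#MH (sym [a+b]*#dyckPaths))

  part₂ : FiniteAbelianGroup.abelianGroup G ≅ CyclicPower n r → FiniteAbelianGroup.abelianGroup H ≅ CyclicPower m r →
          gcd n (m ^ r) ≡ gcd (n ^ r) m → ∃[ N₂ ] (HasCardinality (M G h) N₂ × HasCardinality (M H g) N₂)
  part₂ G≅ H≅ gcd≡ = #MG , CG.M-cardinality h ,
    subst (HasCardinality (M H g)) (sym (#zeroSum-swap G H n m r G≅ H≅ gcd≡)) (CH.M-cardinality g)

  part₃ : k < g → gcd k g ≡ 1 → _
  part₃ k<g coprime =
    sameCardinality⇒bijection {X = N G k} {N G k′} |NGk| |NGk′| #NGk≡#NGk′ ,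
    sameCardinality⇒bijection {X = N G k′} {Dyck k k′} |NGk′| Dyck-cardinality #NGk′≡#Dyck ,
    #NGk , |NGk| , subst (HasCardinality (N G k′)) (sym #NGk≡#NGk′) |NGk′| ,
    fromℕ≡/ g {{order-nonZero G}} g*#NGk ,
    -- The two fractions are compared through `fromℕ #NGk`, since k + (g ∸ k) equals g only
    -- propositionally.
    trans (sym (fromℕ≡/ g {{order-nonZero G}} g*#NGk))
          (fromℕ≡/ (k ℕ.+ k′) {{positive-sum k k′ (ℕ.>-nonZero⁻¹ k)}}
            (trans (cong (ℕ._* #NGk) k+k′≡g) (trans g*#NGk (cong (_C k) (sym k+k′≡g)))))
    where
    module SG = Counting G
    k′ : ℕ
    k′ = g ∸ k

    k+k′≡g : k ℕ.+ k′ ≡ g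
    k+k′≡g = ℕ.m+[n∸m]≡n (ℕ.<⇒≤ k<g)

    coprime-sum : gcd k (k ℕ.+ k′) ≡ 1
    coprime-sum = trans (cong (gcd k) k+k′≡g) coprime

    open CycleLemma k k′ (gcd-+ˡ k k′ coprime-sum)
    |NGk|  = SG.N-cardinality k
    |NGk′| = SG.N-cardinality k′

    #NGk #NGk′ : ℕ
    #NGk  = length (SG.subsets (FiniteAbelianGroup.element G) k (FiniteAbelianGroup.ε G))
    #NGk′ = length (SG.subsets (FiniteAbelianGroup.element G) k′ (FiniteAbelianGroup.ε G))

    g*#NGk : g ℕ.* #NGk ≡ g C k
    g*#NGk = SG.order*#subsets k coprime

    g*#NGk′ : g ℕ.* #NGk′ ≡ g C k
    g*#NGk′ = trans (SG.order*#subsets k′ (trans (cong (gcd k′) (sym k+k′≡g)) (gcd-+ʳ k k′ coprime-sum)))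
      (sym (nCk≡nC[n∸k] (ℕ.<⇒≤ k<g)))

    #NGk≡#NGk′ : #NGk ≡ #NGk′
    #NGk≡#NGk′ = ℕ.*-cancelˡ-≡ _ _ g {{order-nonZero G}} (trans g*#NGk (sym g*#NGk′))

    #NGk′≡#Dyck : #NGk′ ≡ length dyckPaths
    #NGk′≡#Dyck = ℕ.*-cancelˡ-≡ _ _ g {{order-nonZero G}} (trans g*#NGk′
      (trans (cong (_C k) (sym k+k′≡g)) (trans (sym [a+b]*#dyckPaths) (cong (ℕ._* length dyckPaths) k+k′≡g))))
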